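{- Let $n\ge1$ and let $(h^B_{ij})_{0\le j\le i\le n}$ be the $h$-triangle of $\Delta_{\mathrm{SDyck}_{2n}}$. For $0\le j\le i\le n$, \[ h^B_{ij}=\Big|\left\{\,w\in\mathrm{SDyck}_{2n}^{\max} : |V^{\mathrm{half}}(w)|=i\text{ and }\mathrm{suc}_B(w)=i-j\,\right\}\Big| . \]
   Context: A Dyck path of semilength $m$ is a word $w=w_1\cdots w_{2m}$ in $\{U,D\}$ with equally many $U$'s and $D$'s such that every prefix contains at least as many $U$'s as $D$'s. It is symmetric if $w_{2m+1-i}=\overline{w_i}$ for all $1\le i\le 2m$, where $\overline U=D$, $\overline D=U$. $\mathrm{SDyck}_{2n}$ is the set of symmetric Dyck paths of semilength $2n$ (length $4n$). A valley of $w$ is an index $i$ with $w_i=D$, $w_{i+1}=U$, identified with its position $(i,y)$, where $y$ is the number of $U$'s minus the number of $D$'s in $w_1\cdots w_i$; $V(w)$ is the set of valley positions. For $w\in\mathrm{SDyck}_{2n}$ put $V^{\mathrm{half}}(w)=\{(x,y)\in V(w): x\le 2n\}$, and $\Delta_{\mathrm{SDyck}_{2n}}=\{V^{\mathrm{half}}(w) : w\in\mathrm{SDyck}_{2n}\}$, which is a simplicial complex (isomorphic to the complex of antichains in the root poset of type $B_n$). $\mathrm{SDyck}_{2n}^{\max}$ is the set of $w\in\mathrm{SDyck}_{2n}$ for which $V^{\mathrm{half}}(w)$ is a maximal face of $\Delta_{\mathrm{SDyck}_{2n}}$. Define $\mathrm{suc}_B(w)=\big|\{(x,y)\in V^{\mathrm{half}}(w)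 : (x-2,y)\in V^{\mathrm{half}}(w)\cup\{(0,0)\}\}\big|$. For a simplicial complex $\Delta$, the degree of a face $\sigma$ is $\deg(\sigma)=\max\{|\tau| : \tau\in\Delta,\ \sigma\subseteq\tau\}$, and $f_{ij}$ is the number of faces $\sigma$ with $|\sigma|=j$ and $\deg(\sigma)=i$. The $h$-triangle $(h_{ij})_{0\le j\le i}$ is defined by $\sum_{0\le j\le i}h_{ij}x^iy^{i-j}=\sum_{0\le j\le i}f_{ij}x^i(y-1)^{i-j}$. -}

module Defs where

open import Data.Bool.Base using (if_then_else_)
open import Data.Fin.Base using (Fin; opposite)
import Data.Fin.Properties as Fin
open import Data.Integer.Base as ℤ using (ℤ; +_; -_; 0ℤ; 1ℤ; _⊖_)
import Data.Integer.Properties as ℤ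
open import Data.List.Base using (List; []; _∷_; map; filter; length; upTo; take; drop; head; inits; deduplicate; cartesianProductWith)
open import Data.List.Extrema.Nat using (max)
open import Data.List.Relation.Unary.All using (All; all?)
open import Data.List.Relation.Unary.Unique.Propositional using (Unique)
open import Data.List.Relation.Unary.Unique.Propositional.Properties using (map⁺; filter⁺; upTo⁺)
import Data.List.Membership.DecPropositional as DecMembership
import Data.List.Relation.Binary.Subset.DecPropositional as DecSubset
open import Data.Maybe.Base using (Maybe; just; nothing)
import Data.Maybe.Properties as Maybe
open import Data.Nat.Base using (ℕ; zero; suc; _+_; _*_; _∸_; _≤_; _≡ᵇ_)
open import Data.Nat.Properties using (_≟_; _≤?_)
open import Data.Product.Base using (_×_; _,_; proj₁)
import Data.Product.Properties as Product
open import Data.Vec.Base as Vec using (Vec; lookup; toList)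
open import Relation.Binary.Definitions using (DecidableEquality)
open import Relation.Binary.PropositionalEquality using (_≡_; refl; cong)
open import Relation.Nullary.Decidable using (Dec; yes; no; _×-dec_; _→-dec_)

data Step : Set where
  U D : Step

_≟ˢ_ : DecidableEquality Step
U ≟ˢ U = yes refl
U ≟ˢ D = no λ ()
D ≟ˢ U = no λ ()
D ≟ˢ D = yes refl

flip : Step → Step
flip U = D
flip D = U

#_ : Step → List Step → ℕ
(# s) w = length (filter (s ≟ˢ_) w)

IsDyck : ∀ {m} → Vec Step (2 * m) → Set
IsDyck w = (# U) (toList w) ≡ (# D) (toList w)
         × All (λ p → (# D) p ≤ (# U) p) (inits (toList w))

-- With indices from 0, `opposite` sends k to 2m - 1 - k, that is, the
-- index i = k + 1 counted from 1 goes to 2m + 1 - i.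
IsSymmetric : ∀ {m} → Vec Step (2 * m) → Set
IsSymmetric {m} w = (i : Fin (2 * m)) → lookup w (opposite i) ≡ flip (lookup w i)

isDyck? : ∀ {m} (w : Vec Step (2 * m)) → Dec (IsDyck {m} w)
isDyck? w = ((# U) (toList w) ≟ (# D) (toList w))
        ×-dec all? (λ p → (# D) p ≤? (# U) p) (inits (toList w))

isSymmetric? : ∀ {m} (w : Vec Step (2 * m)) → Dec (IsSymmetric {m} w)
isSymmetric? w = Fin.all? λ i → lookup w (opposite i) ≟ˢ flip (lookup w i)

-- Every word of length k, each listed once.
words : (k : ℕ) → List (Vec Step k)
words zero    = Vec.[] ∷ []
words (suc k) = cartesianProductWith Vec._∷_ (U ∷ D ∷ []) (words k)

-- The symmetric Dyck paths of semilength m, each listed once.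
SDyck : (m : ℕ) → List (Vec Step (2 * m))
SDyck m = filter (λ w → isDyck? {m} w ×-dec isSymmetric? {m} w) (words (2 * m))

Position : Set
Position = ℕ × ℤ

_≟ᵖ_ : DecidableEquality Position
_≟ᵖ_ = Product.≡-dec _≟_ ℤ._≟_

open DecMembership _≟ᵖ_ using (_∈_; _∈?_)

-- The i-th letter, counted from 1; `nothing` outside the word.
letter : ∀ {k} → Vec Step k → ℕ → Maybe Step
letter w zero    = nothing
letter w (suc i) = head (drop i (toList w))

IsValley : ∀ {k} → Vec Step k → ℕ → Set
IsValley w i = letter w i ≡ just D × letter w (suc i) ≡ just U

isValley? : ∀ {k} (w : Vec Step k) (i : ℕ) → Dec (IsValley w i)
isValley? w i = Maybe.≡-dec _≟ˢ_ (letter w i) (just D)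
          ×-dec Maybe.≡-dec _≟ˢ_ (letter w (suc i)) (just U)

height : ∀ {k} → Vec Step k → ℕ → ℤ
height w i = (# U) (take i (toList w)) ⊖ (# D) (take i (toList w))

V : ∀ {k} → Vec Step k → List Position
V {k} w = map (λ i → i , height w i) (filter (isValley? w) (upTo k))

Vhalf : (n : ℕ) → Vec Step (2 * (2 * n)) → List Position
Vhalf n w = filter (λ p → proj₁ p ≤? 2 * n) (V w)

-- Hence the length of `Vhalf n w` is its cardinality as a set.
Vhalf-unique : ∀ n w → Unique (Vhalf n w)
Vhalf-unique n w = filter⁺ (λ p → proj₁ p ≤? 2 * n)
  (map⁺ {f = λ i → i , height w i} (cong proj₁)
    (filter⁺ (isValley? w) (upTo⁺ (2 * (2 * n)))))

-- The subtraction x ∸ 2 never truncates: a Dyck path starts with U, so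
-- its valleys have x ≥ 2.
sucB : (n : ℕ) → Vec Step (2 * (2 * n)) → ℕ
sucB n w = length (filter P? (Vhalf n w))
  where
  P? : (p : Position) → Dec (let (x , y) = p in (x ∸ 2 , y) ∈ (0 , 0ℤ) ∷ Vhalf n w)
  P? (x , y) = (x ∸ 2 , y) ∈? ((0 , 0ℤ) ∷ Vhalf n w)

-- A complex is given by a list of its faces, and a face by a list of its
-- vertices without repetitions.  Two lists with the same elements are the
-- same face, and a face may occur more than once in the list of faces.
module Complex {A : Set} (_≟ᵛ_ : DecidableEquality A) where

  open DecSubset _≟ᵛ_ public using (_⊆_; _⊆?_)

  _≐_ : List A → List A → Set
  σ ≐ τ = σ ⊆ τ × τ ⊆ σ

  _≐?_ : (σ τ : List A) → Dec (σ ≐ τ)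
  σ ≐? τ = (σ ⊆? τ) ×-dec (τ ⊆? σ)

  IsMaximalFace : List (List A) → List A → Set
  IsMaximalFace Δ σ = All (λ τ → σ ⊆ τ → τ ⊆ σ) Δ

  isMaximalFace? : (Δ : List (List A)) (σ : List A) → Dec (IsMaximalFace Δ σ)
  isMaximalFace? Δ σ = all? (λ τ → (σ ⊆? τ) →-dec (τ ⊆? σ)) Δ

  deg : List (List A) → List A → ℕ
  deg Δ σ = max 0 (map length (filter (σ ⊆?_) Δ))

  f : List (List A) → ℕ → ℕ → ℕ
  f Δ i j = length (filter (λ σ → (length σ ≟ j) ×-dec (deg Δ σ ≟ i))
                           (deduplicate _≐?_ Δ))

open Complex _≟ᵖ_ public

ΔSDyck : (n : ℕ) → List (List Position)
ΔSDyck n = map (Vhalf n) (SDyck (2 * n))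

SDyckMax : (n : ℕ) → List (Vec Step (2 * (2 * n)))
SDyckMax n = filter (λ w → isMaximalFace? (ΔSDyck n) (Vhalf n w)) (SDyck (2 * n))

-- p a b is the coefficient of x^a y^b.  Finiteness of the support is not
-- imposed, so this is ℤ[[x,y]], which contains ℤ[x,y] as a subring.
Poly : Set
Poly = ℕ → ℕ → ℤ

_≈_ : Poly → Poly → Set
p ≈ q = ∀ a b → p a b ≡ q a b

∑≤ : ℕ → (ℕ → ℤ) → ℤ
∑≤ zero    g = g 0
∑≤ (suc d) g = ∑≤ d g ℤ.+ g (suc d)

const : ℤ → Poly
const c zero zero = c
const c _    _    = 0ℤ

X Y : Poly
X a b = if a ≡ᵇ 1 then (if b ≡ᵇ 0 then 1ℤ else 0ℤ) else 0ℤ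
Y a b = if a ≡ᵇ 0 then (if b ≡ᵇ 1 then 1ℤ else 0ℤ) else 0ℤ

infixl 6 _⊕_
infixl 7 _⊗_
infixr 8 _^_

_⊕_ : Poly → Poly → Poly
(p ⊕ q) a b = p a b ℤ.+ q a b

_⊗_ : Poly → Poly → Poly
(p ⊗ q) a b = ∑≤ a λ a′ → ∑≤ b λ b′ → p a′ b′ ℤ.* q (a ∸ a′) (b ∸ b′)

_^_ : Poly → ℕ → Poly
p ^ zero  = const 1ℤ
p ^ suc k = p ⊗ p ^ k

-- The sum of F i j over 0 ≤ j ≤ i ≤ d.
∑△ : ℕ → (ℕ → ℕ → Poly) → Poly
∑△ d F a b = ∑≤ d λ i → ∑≤ i λ j → F i j a b

-- (h i j) for 0 ≤ j ≤ i ≤ d is the h-triangle of Δ, where every face of Δ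
-- is assumed to have at most d vertices, so that f Δ i j = 0 for i > d.
-- Values of h outside this range are irrelevant.
IsHTriangle : {A : Set} (_≟ᵛ_ : DecidableEquality A) →
              ℕ → List (List A) → (ℕ → ℕ → ℤ) → Set
IsHTriangle _≟ᵛ_ d Δ h =
    ∑△ d (λ i j → const (h i j) ⊗ X ^ i ⊗ Y ^ (i ∸ j))
  ≈ ∑△ d (λ i j → const (+ Complex.f _≟ᵛ_ Δ i j) ⊗ X ^ i ⊗ (Y ⊕ const (- 1ℤ)) ^ (i ∸ j))

{-# OPTIONS --safe #-}
-- In the coordinates u = #U, d = #D, the valleys of a half path are a chain in
-- the strict product order, so the faces are the chains in a triangle.  Every
-- face lies in a facet obtained by filling each gap (a , b) diagonally from
-- below with min (a , b) - 1 points, and the points added have their diagonal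
-- predecessor (u - 1 , d - 1) in the facet; hence the faces of a given degree
-- correspond to the pairs of a facet of that size and a subset of its points
-- counted by suc_B.  This gives
--   Σ_faces x^deg (y - 1)^(deg - size) = Σ_facets x^size y^suc_B,
-- which is the asserted h-triangle.  The identity is proved letter by letter:
-- unless the first gap (a , b) has min (a , b) = 1, removing a peak UD from it
-- divides the weight of the face by x (y - 1).

module Submission where

open import Defs
open import Data.Bool.Base using (if_then_else_)
open import Data.Empty using (⊥; ⊥-elim)
open import Data.Fin.Base as Fin using (opposite)
import Data.Fin.Properties as Fin
open import Data.Integer.Base as ℤ using (ℤ; +_; _⊖_; 0ℤ; 1ℤ)
import Data.Integer.Properties as ℤ
open import Algebra.Properties.CommutativeSemigroup ℤ.+-commutativeSemigroup using (x∙yz≈y∙xz) renaming (interchange to +-exchange)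
open import Data.List.Base as List using (List; []; _∷_; length; _++_; filter; map; reverse; take; drop; head; inits; deduplicate; upTo)
open import Data.List.Extrema.Nat using (max≤v⁺; v≤max⁺)
open import Data.List.Membership.Propositional using (_∈_; lose)
open import Data.List.Membership.Propositional.Properties
open import Data.List.Membership.Propositional.Properties.WithK using (unique∧set⇒bag)
open import Data.List.Membership.DecPropositional _≟ᵖ_ using (_∈?_)
import Data.List.Properties as List
open import Data.List.Relation.Binary.BagAndSetEquality using (∼bag⇒↭)
open import Data.List.Relation.Binary.Permutation.Propositional using (_↭_; ↭-sym)
open import Data.List.Relation.Binary.Permutation.Propositional.Properties using (∈-resp-↭; filter-↭; ↭-length)
open import Data.List.Relation.Binary.Subset.Propositional using () renaming (_⊆_ to _⊆ₗ_)
open import Data.List.Relation.Unary.All as All using (All; []; _∷_)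
import Data.List.Relation.Unary.All.Properties as All
open import Data.List.Relation.Unary.AllPairs using (AllPairs; []; _∷_)
import Data.List.Relation.Unary.AllPairs.Properties as AllPairs
open import Data.List.Relation.Unary.Any using (here; there)
open import Data.List.Relation.Unary.Unique.Propositional using (Unique)
import Data.List.Relation.Unary.Unique.Propositional.Properties as Unique
open import Data.Maybe.Base using (Maybe; just)
open import Data.Nat.Base hiding (_^_)
open import Data.Nat.Properties
open import Data.Product.Base using (_×_; _,_; proj₁; proj₂; ∃; ∃₂)
open import Data.Sum.Base using (inj₁; inj₂)
open import Data.Vec.Base as Vec using (Vec; toList; lookup)
import Data.Vec.Properties as Vec
open import Function.Base using (_∘_; id)
open import Function.Bundles using (mk⇔)
open import Level using (0ℓ)
open import Relation.Binary.PropositionalEquality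
open import Relation.Nullary using (¬_; Dec; yes; no; contradiction; does)
open import Relation.Nullary.Decidable using (_×-dec_; dec-true; dec-false)
open import Relation.Unary using (Pred; Decidable)

-- Put z = y - 1, and let F be the total weight of the continuations, with two letters fewer, that
-- begin at a valley of the same height. A first gap (1 , 1) leaves x F. A first gap with min (a ,
-- b) at least 2 becomes an arbitrary nonempty continuation with its first descent present when a
-- peak is removed; a final ascent of length at least 2 loses two letters U instead. Together these
-- leave x z F. The sum x F + x z F = x y F is what the facets with first gap (1 , 1) receive, the
-- factor y being the point counted by suc_B. All other words have the same first factor on both
-- sides and follow by induction on the length. Only y = z + 1 is used, so the weights are an
-- arbitrary function `ω` with that relation, later taken to be a coefficient of the monomial.
--
-- The degree is a minimum because an added point lies strictly between its neighbours in both
-- coordinates. After the last valley only u + d is bounded, the end height of a half path being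
-- free; hence the halving there.

-- Half words

-- A gap U^a D^b contributes min (a , b) to the degree and min (a , b) - 1 to
-- the defect, and a final ascent U^a contributes ⌊ a /2⌋ to both.
-- In state `U , k` the current ascent has length k; in state `D , k` the
-- current descent is shorter by k than the ascent before it (k = 0 if it is
-- not shorter).  A word read from the origin starts in state `U , 0`.
degree defect : Step → ℕ → List Step → ℕ
degree U k       []      = ⌊ k /2⌋
degree U k       (U ∷ p) = degree U (suc k) p
degree U k       (D ∷ p) = suc (degree D (pred k) p)
degree D k       []      = 0
degree D k       (U ∷ p) = degree U 1 p
degree D zero    (D ∷ p) = degree D 0 p
degree D (suc k) (D ∷ p) = suc (degree D k p)

defect U k       []      = ⌊ k /2⌋
defect U k       (U ∷ p) = defect U (suc k) p
defect U k       (D ∷ p) = defect D (pred k) p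
defect D k       []      = 0
defect D k       (U ∷ p) = defect U 1 p
defect D zero    (D ∷ p) = defect D 0 p
defect D (suc k) (D ∷ p) = suc (defect D k p)

isOne : ℕ → ℕ
isOne 1 = 1
isOne _ = 0

-- In state `D , k` the gap below the current position is (1 , 1) if and
-- only if k = 1.
unitSteps : Step → ℕ → List Step → ℕ
unitSteps U k []      = 0
unitSteps U k (U ∷ p) = unitSteps U (suc k) p
unitSteps U k (D ∷ p) = unitSteps D k p
unitSteps D k []      = isOne k
unitSteps D k (U ∷ p) = isOne k + unitSteps U 1 p
unitSteps D k (D ∷ p) = unitSteps D 0 p

Point : Set
Point = ℕ × ℕ

-- A valley (x , y) is recorded as (u , d) with x = u + d and y = u - d.  The
-- step argument is the letter preceding the word.  A final D counts as a
-- valley, since the second half of the path then starts with U.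
valleys : Step → ℕ → ℕ → List Step → List Point
valleys U u d []      = []
valleys U u d (U ∷ p) = valleys U (suc u) d p
valleys U u d (D ∷ p) = valleys D u (suc d) p
valleys D u d []      = (u , d) ∷ []
valleys D u d (U ∷ p) = (u , d) ∷ valleys U (suc u) d p
valleys D u d (D ∷ p) = valleys D u (suc d) p

-- Each gap gives min (a , b) = (min (a , b) - 1) + 1, the 1 being its valley. The `suc` in
-- `degree-D` is the 1 already counted at the first D of the current descent, whose valley is still
-- to come.
degree-U : ∀ k u d p → degree U k p ≡ defect U k p + length (valleys U u d p)
degree-D : ∀ k u d p → suc (degree D k p) ≡ defect D k p + length (valleys D u d p)
degree-U k u d []      = sym (+-identityʳ _)
degree-U k u d (U ∷ p) = degree-U (suc k) (suc u) d p
degree-U k u d (D ∷ p) = degree-D (pred k) u (suc d) p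
degree-D k       u d []      = refl
degree-D k       u d (U ∷ p) = trans (cong suc (degree-U 1 (suc u) d p)) (sym (+-suc _ _))
degree-D zero    u d (D ∷ p) = degree-D 0 u (suc d) p
degree-D (suc k) u d (D ∷ p) = cong suc (degree-D k u (suc d) p)

-- Chains of valleys

data Chain (N : ℕ) : Point → List Point → Set where
  []  : ∀ {v} → Chain N v []
  _∷_ : ∀ {u d u′ d′ L} → u < u′ × d < d′ × u′ + d′ ≤ N →
        Chain N (u′ , d′) L → Chain N (u , d) ((u′ , d′) ∷ L)

valleysU-chain : ∀ {N u₀ d₀} u d p → u₀ < u → d₀ ≤ d → u + d + length p ≤ N →
                 Chain N (u₀ , d₀) (valleys U u d p)
valleysD-chain : ∀ {N u₀ d₀} u d p → u₀ < u → d₀ < d → u + d + length p ≤ N →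
                 Chain N (u₀ , d₀) (valleys D u d p)
shiftU : ∀ {N} u d p → u + d + suc (length p) ≤ N → suc u + d + length p ≤ N
shiftU {N} u d p = subst (_≤ N) (+-suc (u + d) (length p))
shiftD : ∀ {N} u d p → u + d + suc (length p) ≤ N → u + suc d + length p ≤ N
shiftD {N} u d p = subst (_≤ N) (trans (+-suc (u + d) (length p)) (cong (_+ length p) (sym (+-suc u d))))
valleysU-chain u d []      a b c = []
valleysU-chain u d (U ∷ p) a b c = valleysU-chain (suc u) d p (m≤n⇒m≤1+n a) b (shiftU u d p c)
valleysU-chain u d (D ∷ p) a b c = valleysD-chain u (suc d) p a (s≤s b) (shiftD u d p c)
valleysD-chain u d []      a b c = (a , b , m+n≤o⇒m≤o (u + d) c) ∷ []
valleysD-chain u d (U ∷ p) a b c = (a , b , m+n≤o⇒m≤o (u + d) c) ∷ valleysU-chain (suc u) d p ≤-refl ≤-refl (shiftU u d p c)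
valleysD-chain u d (D ∷ p) a b c = valleysD-chain u (suc d) p a (m≤n⇒m≤1+n b) (shiftD u d p c)

chain⇒< : ∀ {N v L z} → Chain N v L → z ∈ L → proj₁ v < proj₁ z × proj₂ v < proj₂ z
chain⇒< ((a , b , _) ∷ c) (here refl) = a , b
chain⇒< ((a , b , _) ∷ c) (there z∈) with chain⇒< c z∈
... | a′ , b′ = <-trans a a′ , <-trans b b′

-- An element added to the gap (a , b) lowers min (a , b) by at least 1, and one
-- added after the last point raises u + d, which is at most N, by at least 2.
capacity : ℕ → Point → List Point → ℕ
capacity N (u , d) []              = ⌊ N ∸ (u + d) /2⌋
capacity N (u , d) ((u′ , d′) ∷ L) = (u′ ∸ u) ⊓ (d′ ∸ d) + capacity N (u′ , d′) L

suc-∸-mono : ∀ {a b c} → a < b → b < c → suc (c ∸ b) ≤ c ∸ a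
suc-∸-mono {a} {b} {c} a<b b<c = ≤-trans (≤-reflexive (sym (+-∸-assoc 1 (<⇒≤ b<c)))) (∸-monoʳ-≤ (suc c) a<b)

chain-length≤capacity : ∀ {N v} L L′ → Chain N v L → Chain N v L′ → L ⊆ₗ L′ → length L′ ≤ capacity N v L
chain-length≤capacity L [] _ _ _ = z≤n
chain-length≤capacity {N} {u , d} [] ((u′ , d′) ∷ L′) _ ((a , b , e) ∷ c′) _ = begin
  suc (length L′)                  ≤⟨ s≤s (chain-length≤capacity [] L′ [] c′ λ ()) ⟩
  ⌊ 2 + (N ∸ (u′ + d′)) /2⌋        ≤⟨ ⌊n/2⌋-mono two ⟩
  ⌊ N ∸ (u + d) /2⌋                ∎
  where
  open ≤-Reasoning
  two : 2 + (N ∸ (u′ + d′)) ≤ N ∸ (u + d)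
  two = begin
    2 + (N ∸ (u′ + d′))       ≡⟨ +-∸-assoc 2 e ⟨
    2 + N ∸ (u′ + d′)         ≤⟨ ∸-monoʳ-≤ (2 + N) (+-mono-≤ a b) ⟩
    2 + N ∸ (suc u + suc d)   ≡⟨ cong (suc N ∸_) (+-suc u d) ⟩
    N ∸ (u + d)               ∎
chain-length≤capacity {N} {u , d} ((x , y) ∷ L) ((u′ , d′) ∷ L′) ((a , b , _) ∷ c) ((a′ , b′ , _) ∷ c′) sub
  with sub (here refl)
-- Nothing is inserted into the first gap any more; its minimum is at least 1 and pays for its own
-- endpoint.
... | here refl = +-mono-≤ (⊓-glb (m<n⇒0<n∸m a) (m<n⇒0<n∸m b)) (chain-length≤capacity L L′ c c′ sub′)
  where
  sub′ : L ⊆ₗ L′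
  sub′ z∈ with sub (there z∈)
  ... | here refl = contradiction (proj₁ (chain⇒< c z∈)) (<-irrefl refl)
  ... | there z∈′ = z∈′
-- The first point of `L′` lies inside the first gap of `L`. Measured from this point, both sides of
-- the gap are shorter by at least 1.
... | there w∈ = begin
  suc (length L′)                                     ≤⟨ s≤s (chain-length≤capacity ((x , y) ∷ L) L′ (gap ∷ c) c′ sub′) ⟩
  suc ((x ∸ u′) ⊓ (y ∸ d′)) + capacity N (x , y) L         ≤⟨ +-monoˡ-≤ _ (⊓-mono-≤ (suc-∸-mono a′ (proj₁ lt)) (suc-∸-mono b′ (proj₂ lt))) ⟩
  (x ∸ u) ⊓ (y ∸ d) + capacity N (x , y) L                 ∎
  where
  open ≤-Reasoning
  lt : u′ < x × d′ < y
  lt = chain⇒< c′ w∈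
  gap : u′ < x × d′ < y × _
  gap = proj₁ lt , proj₂ lt , bound c′ w∈
    where
    bound : ∀ {v K} → Chain N v K → (x , y) ∈ K → x + y ≤ N
    bound ((_ , _ , e) ∷ _) (here refl) = e
    bound (_ ∷ c) (there z∈) = bound c z∈
  sub′ : (x , y) ∷ L ⊆ₗ L′
  sub′ z∈ with sub z∈
  ... | there z∈′ = z∈′
  sub′ (here refl) | here refl = w∈
  sub′ (there z∈) | here refl = contradiction (<-trans (proj₁ lt) (proj₁ (chain⇒< c z∈))) (<-irrefl refl)

-- A further D raises the minimum exactly while `b < a`, that is, while the state `a ∸ b` is
-- positive.
degree-D-step : ∀ a b p → a ⊓ suc b + degree D (a ∸ suc b) p ≡ a ⊓ b + degree D (a ∸ b) (D ∷ p)
degree-D-step zero    zero    p = refl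
degree-D-step zero    (suc b) p = refl
degree-D-step (suc a) zero    p = cong (λ z → suc z + degree D a p) (⊓-zeroʳ a)
degree-D-step (suc a) (suc b) p = cong suc (degree-D-step a b p)

-- The letters read since the valley `(u , d)` are `suc k` U's, or `a` U's and `b` D's; `degree`
-- remembers only `a ∸ b` of the latter. The equation for `N` makes a final ascent use up exactly
-- the room left after the last valley.
capacityU : ∀ {N} k u d p → N ≡ suc k + u + d + length p →
       capacity N (u , d) (valleys U (suc k + u) d p) ≡ degree U (suc k) p
capacityD : ∀ {N} a b u d p → N ≡ a + u + (b + d) + length p →
       capacity N (u , d) (valleys D (a + u) (b + d) p) ≡ a ⊓ b + degree D (a ∸ b) p
capacityU {N} k u d [] e = cong ⌊_/2⌋ (begin
  N ∸ (u + d)                       ≡⟨ cong (_∸ (u + d)) (trans e (trans (+-identityʳ _) (+-assoc (suc k) u d))) ⟩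
  suc k + (u + d) ∸ (u + d)         ≡⟨ m+n∸n≡m (suc k) (u + d) ⟩
  suc k                             ∎)
  where open ≡-Reasoning
capacityU k u d (U ∷ p) e = capacityU (suc k) u d p (trans e (+-suc _ (length p)))
capacityU k u d (D ∷ p) e = trans
  (capacityD (suc k) 1 u d p (trans e (trans (+-suc _ (length p)) (cong (_+ length p) (sym (+-suc (suc k + u) d))))))
  (cong (λ z → suc z + degree D k p) (⊓-zeroʳ k))
capacityD a b u d [] e = cong₂ (λ x y → x + y) (cong₂ _⊓_ (m+n∸n≡m a u) (m+n∸n≡m b d))
  (cong ⌊_/2⌋ (trans (cong (_∸ (a + u + (b + d))) (trans e (+-identityʳ _))) (n∸n≡0 (a + u + (b + d)))))
capacityD a b u d (U ∷ p) e = cong₂ _+_ (cong₂ _⊓_ (m+n∸n≡m a u) (m+n∸n≡m b d))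
  (capacityU 0 (a + u) (b + d) p (trans e (+-suc _ (length p))))
capacityD a b u d (D ∷ p) e = trans
  (capacityD a (suc b) u d p (trans e (trans (+-suc _ (length p)) (cong (_+ length p) (sym (+-suc (a + u) (b + d)))))))
  (degree-D-step a b p)

length-valleys≤degree : ∀ p p′ → length p ≡ length p′ → valleys U 1 0 p ⊆ₗ valleys U 1 0 p′ →
                      length (valleys U 1 0 p′) ≤ degree U 1 p
length-valleys≤degree p p′ e sub = subst (length (valleys U 1 0 p′) ≤_) (capacityU 0 0 0 p refl)
  (chain-length≤capacity (valleys U 1 0 p) (valleys U 1 0 p′)
    (valleysU-chain 1 0 p ≤-refl ≤-refl ≤-refl)
    (valleysU-chain 1 0 p′ ≤-refl ≤-refl (≤-reflexive (cong suc (sym e)))) sub)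

-- Recovering a half word from its valleys

valleysU-bound : ∀ u d p {z} → z ∈ valleys U u d p → u ≤ proj₁ z × d < proj₂ z
valleysD-bound : ∀ u d p {z} → z ∈ valleys D u d p → u ≤ proj₁ z × d ≤ proj₂ z
valleysU-bound u d (U ∷ p) z∈ with valleysU-bound (suc u) d p z∈
... | a , b = <⇒≤ a , b
valleysU-bound u d (D ∷ p) z∈ = valleysD-bound u (suc d) p z∈
valleysD-bound u d []      (here refl) = ≤-refl , ≤-refl
valleysD-bound u d (U ∷ p) (here refl) = ≤-refl , ≤-refl
valleysD-bound u d (U ∷ p) (there z∈) with valleysU-bound (suc u) d p z∈
... | a , b = <⇒≤ a , <⇒≤ b
valleysD-bound u d (D ∷ p) z∈ with valleysD-bound u (suc d) p z∈
... | a , b = a , <⇒≤ b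

valleysD-first : ∀ u d p → ∃ λ d′ → (u , d′) ∈ valleys D u d p
valleysD-first u d []      = d , here refl
valleysD-first u d (U ∷ p) = d , here refl
valleysD-first u d (D ∷ p) = valleysD-first u (suc d) p

descent⊈ascent : ∀ {u d d′} p q → ¬ (valleys D u d p ⊆ₗ valleys U (suc u) d′ q)
descent⊈ascent {u} {d} p q sub with valleysD-first u d p
... | _ , z∈ = <-irrefl refl (proj₁ (valleysU-bound (suc u) _ q (sub z∈)))

valley⊈descent : ∀ {u d L} q → ¬ ((u , d) ∷ L ⊆ₗ valleys D u (suc d) q)
valley⊈descent {u} {d} q sub = <-irrefl refl (proj₂ (valleysD-bound u (suc d) q (sub (here refl))))

∷-⊆-strip : ∀ {u d} p q → (u , d) ∷ valleys U (suc u) d p ⊆ₗ (u , d) ∷ valleys U (suc u) d q →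
            valleys U (suc u) d p ⊆ₗ valleys U (suc u) d q
∷-⊆-strip p q sub z∈ with sub (there z∈)
... | here refl = contradiction (proj₁ (valleysU-bound _ _ p z∈)) (<-irrefl refl)
... | there z∈′ = z∈′

-- Consider the first letter where the words differ. In an ascent, turning down yields a valley with
-- the current `u` (a final D counts as one), while going up makes every later `u` larger. In a
-- descent, turning up makes the current point a valley, while going down makes every later `d`
-- larger.
valleys-injective : ∀ t u d p q → length p ≡ length q → valleys t u d p ⊆ₗ valleys t u d q →
                    valleys t u d q ⊆ₗ valleys t u d p → p ≡ q
valleys-injective t u d []      []      e a b = refl
valleys-injective U u d (U ∷ p) (U ∷ q) e a b = cong (U ∷_) (valleys-injective U (suc u) d p q (suc-injective e) a b)
valleys-injective U u d (D ∷ p) (D ∷ q) e a b = cong (D ∷_) (valleys-injective D u (suc d) p q (suc-injective e) a b)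
valleys-injective U u d (U ∷ p) (D ∷ q) e a b = ⊥-elim (descent⊈ascent q p b)
valleys-injective U u d (D ∷ p) (U ∷ q) e a b = ⊥-elim (descent⊈ascent p q a)
valleys-injective D u d (U ∷ p) (U ∷ q) e a b =
  cong (U ∷_) (valleys-injective U (suc u) d p q (suc-injective e) (∷-⊆-strip p q a) (∷-⊆-strip q p b))
valleys-injective D u d (D ∷ p) (D ∷ q) e a b = cong (D ∷_) (valleys-injective D u (suc d) p q (suc-injective e) a b)
valleys-injective D u d (U ∷ p) (D ∷ q) e a b = ⊥-elim (valley⊈descent q a)
valleys-injective D u d (D ∷ p) (U ∷ q) e a b = ⊥-elim (valley⊈descent p b)

-- Ballot words and the filling of their gaps

data Path : ℕ → List Step → ℕ → Set where
  []   : ∀ {h} → Path h [] h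
  up   : ∀ {h p e} → Path (suc h) p e → Path h (U ∷ p) e
  down : ∀ {h p e} → Path h p e → Path (suc h) (D ∷ p) e

Ballot : ℕ → List Step → Set
Ballot h p = ∃ (Path h p)

ballot-up : ∀ {h p} → Ballot (suc h) p → Ballot h (U ∷ p)
ballot-up (e , π) = e , up π
ballot-down : ∀ {h p} → Ballot h p → Ballot (suc h) (D ∷ p)
ballot-down (e , π) = e , down π

ups : ℕ → List Step → List Step
ups zero    p = p
ups (suc k) p = U ∷ ups k p

-- The filling of a final ascent: every two of its letters make room for one valley, and an odd
-- letter remains as a final U.
zigzag : ℕ → List Step
zigzag zero          = []
zigzag (suc zero)    = U ∷ []
zigzag (suc (suc k)) = U ∷ D ∷ zigzag k

-- An ascent followed by a descent, U^a D^b with c = min (a , b), becomes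
-- (UD)^(c-1) U^(a-c+1) D^(b-c+1).  The letters read but not yet written are
-- U^k in fillU k, and U^(k+1) D in fillD k.
fillU fillD : ℕ → List Step → List Step
-- The rest of a descent that has become longer than its ascent is copied; no letter is pending.
fillE : List Step → List Step
fillU k       []      = zigzag k
fillU k       (U ∷ p) = fillU (suc k) p
fillU k       (D ∷ p) = fillD (pred k) p
fillD k       []      = ups k (U ∷ D ∷ [])
fillD k       (U ∷ p) = ups k (U ∷ D ∷ fillU 1 p)
fillD zero    (D ∷ p) = U ∷ D ∷ D ∷ fillE p
fillD (suc k) (D ∷ p) = U ∷ D ∷ fillD k p
fillE []      = []
fillE (U ∷ p) = fillU 1 p
fillE (D ∷ p) = D ∷ fillE p

length-ups : ∀ k p → length (ups k p) ≡ k + length p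
length-ups zero    p = refl
length-ups (suc k) p = cong suc (length-ups k p)

length-zigzag : ∀ k → length (zigzag k) ≡ k
length-zigzag zero          = refl
length-zigzag (suc zero)    = refl
length-zigzag (suc (suc k)) = cong (suc ∘ suc) (length-zigzag k)

length-fillU : ∀ k p → length (fillU (suc k) p) ≡ suc k + length p
length-fillD : ∀ k p → length (fillD k p) ≡ 2 + k + length p
length-fillE : ∀ p → length (fillE p) ≡ length p
length-fillU k []      = trans (length-zigzag (suc k)) (sym (+-identityʳ _))
length-fillU k (U ∷ p) = trans (length-fillU (suc k) p) (sym (+-suc (suc k) (length p)))
length-fillU k (D ∷ p) = trans (length-fillD k p) (sym (+-suc (suc k) (length p)))
length-fillD k [] = trans (length-ups k _) (trans (+-comm k 2) (sym (+-identityʳ _)))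
length-fillD k (U ∷ p) = trans (length-ups k _) (trans (cong (λ z → k + (2 + z)) (length-fillU 0 p)) (trans (+-suc k _) (cong suc (+-suc k _))))
length-fillD zero    (D ∷ p) = cong (λ l → 3 + l) (length-fillE p)
length-fillD (suc k) (D ∷ p) = cong (λ l → 2 + l) (trans (length-fillD k p) (cong suc (sym (+-suc k (length p)))))
length-fillE []      = refl
length-fillE (U ∷ p) = length-fillU 0 p
length-fillE (D ∷ p) = cong suc (length-fillE p)

ups-ballot : ∀ k {h p} → Ballot (k + h) p → Ballot h (ups k p)
ups-ballot zero    b = b
ups-ballot (suc k) {h} {p} b = ballot-up (ups-ballot k (subst (λ z → Ballot z p) (sym (+-suc k h)) b))

zigzag-ballot : ∀ k {h} → Ballot h (zigzag k)
zigzag-ballot zero          = _ , []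
zigzag-ballot (suc zero)    = _ , up []
zigzag-ballot (suc (suc k)) = ballot-up (ballot-down (zigzag-ballot k))

-- `h` is the height before the pending letters. Each inserted peak UD starts and ends there, so the
-- filled word goes below `h` only where the original descent does.
fillU-ballot : ∀ k {h} p → Ballot (suc k + h) p → Ballot h (fillU (suc k) p)
fillD-ballot : ∀ k {h} p → Ballot (k + h) p → Ballot h (fillD k p)
fillE-ballot : ∀ {h} p → Ballot h p → Ballot h (fillE p)
fillU-ballot k []      b              = zigzag-ballot (suc k)
fillU-ballot k (U ∷ p) (_ , up π)     = fillU-ballot (suc k) p (_ , π)
fillU-ballot k (D ∷ p) (_ , down π)   = fillD-ballot k p (_ , π)
fillD-ballot k []      b              = ups-ballot k (ballot-up (ballot-down b))
fillD-ballot k (U ∷ p) (_ , up π)     = ups-ballot k (ballot-up (ballot-down (fillU-ballot 0 p (_ , π))))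
fillD-ballot zero    (D ∷ p) (_ , down π) = ballot-up (ballot-down (ballot-down (fillE-ballot p (_ , π))))
fillD-ballot (suc k) (D ∷ p) (_ , down π) = ballot-up (ballot-down (fillD-ballot k p (_ , π)))
fillE-ballot []      b            = b
fillE-ballot (U ∷ p) (_ , up π)   = fillU-ballot 0 p (_ , π)
fillE-ballot (D ∷ p) (_ , down π) = ballot-down (fillE-ballot p (_ , π))

StartsU : List Step → Set
StartsU p = ∃ λ q → p ≡ U ∷ q

valleysD-startsU : ∀ {u d p} → StartsU p → valleys D u d p ≡ (u , d) ∷ valleys U u d p
valleysD-startsU (_ , refl) = refl

-- Ensures that a D written just before the rest of the filling is a valley.
fillD-startsU : ∀ k p → StartsU (fillD k p)
fillD-startsU zero    []      = _ , refl
fillD-startsU (suc k) []      = _ , refl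
fillD-startsU zero    (U ∷ p) = _ , refl
fillD-startsU (suc k) (U ∷ p) = _ , refl
fillD-startsU zero    (D ∷ p) = _ , refl
fillD-startsU (suc k) (D ∷ p) = _ , refl

fillU-startsU : ∀ k p → StartsU (fillU (suc k) p)
fillU-startsU zero    []      = _ , refl
fillU-startsU (suc k) []      = _ , refl
fillU-startsU k       (U ∷ p) = fillU-startsU (suc k) p
fillU-startsU k       (D ∷ p) = fillD-startsU k p

valleysD-zigzag : ∀ {u d} k → valleys D u d (zigzag k) ≡ (u , d) ∷ valleys U u d (zigzag k)
valleysD-zigzag zero          = refl
valleysD-zigzag (suc zero)    = refl
valleysD-zigzag (suc (suc k)) = refl

valleys-ups : ∀ k u d p → valleys U u d (ups k p) ≡ valleys U (k + u) d p
valleys-ups zero    u d p = refl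
valleys-ups (suc k) u d p = trans (valleys-ups k (suc u) d p) (cong (λ z → valleys U z d p) (+-suc k u))

length-valleys-zigzag : ∀ k u d → length (valleys U u d (zigzag k)) ≡ ⌊ k /2⌋
length-valleys-zigzag zero          u d = refl
length-valleys-zigzag (suc zero)    u d = refl
length-valleys-zigzag (suc (suc k)) u d = trans (cong length (valleysD-zigzag k))
  (cong suc (length-valleys-zigzag k (suc u) (suc d)))

-- The filling writes a peak, ending in a valley, where `degree` adds 1. The `suc` for `fillD` is
-- the pending D, and the one for `fillE` the valley ending the current descent.
length-valleys-fillU : ∀ k u d p → length (valleys U u d (fillU (suc k) p)) ≡ degree U (suc k) p
length-valleys-fillD : ∀ k u d p → length (valleys U u d (fillD k p)) ≡ suc (degree D k p)
length-valleys-fillE : ∀ u d p → length (valleys D u d (fillE p)) ≡ suc (degree D 0 p)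
length-valleys-fillU k u d []      = length-valleys-zigzag (suc k) u d
length-valleys-fillU k u d (U ∷ p) = length-valleys-fillU (suc k) u d p
length-valleys-fillU k u d (D ∷ p) = length-valleys-fillD k u d p
length-valleys-fillD k u d []      = cong length (valleys-ups k u d _)
length-valleys-fillD k u d (U ∷ p) = trans (cong length (valleys-ups k u d _))
  (trans (cong length (valleysD-startsU (fillU-startsU 0 p))) (cong suc (length-valleys-fillU 0 (suc (k + u)) (suc d) p)))
length-valleys-fillD zero    u d (D ∷ p) = length-valleys-fillE (suc u) (suc (suc d)) p
length-valleys-fillD (suc k) u d (D ∷ p) =
  trans (cong length (valleysD-startsU (fillD-startsU k p))) (cong suc (length-valleys-fillD k (suc u) (suc d) p))
length-valleys-fillE u d []      = refl
length-valleys-fillE u d (U ∷ p) =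
  trans (cong length (valleysD-startsU (fillU-startsU 0 p))) (cong suc (length-valleys-fillU 0 u d p))
length-valleys-fillE u d (D ∷ p) = length-valleys-fillE u (suc d) p

-- Letters are rearranged only inside a gap, so the filled word passes through the endpoint of every
-- gap and turns there as well.
valleys⊆fillU : ∀ k u d p → valleys U (suc k + u) d p ⊆ₗ valleys U u d (fillU (suc k) p)
valleys⊆fillD : ∀ k u d p → valleys D (suc k + u) (suc d) p ⊆ₗ valleys U u d (fillD k p)
valleys⊆fillE : ∀ u d p → valleys D u d p ⊆ₗ valleys D u d (fillE p)
valleys⊆fillU k u d (U ∷ p) = valleys⊆fillU (suc k) u d p
valleys⊆fillU k u d (D ∷ p) = valleys⊆fillD k u d p
valleys⊆fillD k u d [] z∈ = subst (_ ∈_) (sym (valleys-ups k u d _)) z∈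
valleys⊆fillD k u d (U ∷ p) z∈ = subst (_ ∈_)
  (sym (trans (valleys-ups k u d _) (valleysD-startsU (fillU-startsU 0 p)))) (help z∈)
  where
  help : (suc k + u , suc d) ∷ valleys U (suc (suc k + u)) (suc d) p ⊆ₗ
         (suc k + u , suc d) ∷ valleys U (suc k + u) (suc d) (fillU 1 p)
  help (here e)   = here e
  help (there z∈) = there (valleys⊆fillU 0 (suc k + u) (suc d) p z∈)
valleys⊆fillD zero    u d (D ∷ p) = valleys⊆fillE (suc u) (suc (suc d)) p
valleys⊆fillD (suc k) u d (D ∷ p) {x} z∈ = subst (_ ∈_) (sym (valleysD-startsU (fillD-startsU k p)))
  (there (valleys⊆fillD k (suc u) (suc d) p (subst (λ z → x ∈ valleys D z (suc (suc d)) p) (cong suc (sym (+-suc k u))) z∈)))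
valleys⊆fillE u d []      z∈ = z∈
valleys⊆fillE u d (U ∷ p) z∈ = subst (_ ∈_) (sym (valleysD-startsU (fillU-startsU 0 p))) (help z∈)
  where
  help : (u , d) ∷ valleys U (suc u) d p ⊆ₗ (u , d) ∷ valleys U u d (fillU 1 p)
  help (here e)   = here e
  help (there z∈) = there (valleys⊆fillU 0 u d p z∈)
valleys⊆fillE u d (D ∷ p) z∈ = valleys⊆fillE u (suc d) p z∈

-- Gaps (1 , 1) and the points counted by suc_B

unitGaps : Point → List Point → ℕ
unitGaps v             []              = 0
unitGaps (u , d) ((u′ , d′) ∷ L) = isOne (u′ ∸ u) * isOne (d′ ∸ d) + unitGaps (u′ , d′) L

-- The hypothesis on `e` is the invariant of the state `D , e`: the gap read so far, `(a , suc b)`,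
-- is (1 , 1) exactly when `e` is 1.
unitGapsU≡unitSteps : ∀ k u d p → unitGaps (u , d) (valleys U (k + u) d p) ≡ unitSteps U k p
unitGapsD≡unitSteps : ∀ a b e u d p → isOne e ≡ isOne a * isOne (suc b) →
            unitGaps (u , d) (valleys D (a + u) (suc b + d) p) ≡ unitSteps D e p
gap-head : ∀ a b e u d → isOne e ≡ isOne a * isOne (suc b) →
           isOne (a + u ∸ u) * isOne (suc b + d ∸ d) ≡ isOne e
gap-head a b e u d eq = trans (cong₂ (λ x y → isOne x * isOne y) (m+n∸n≡m a u) (m+n∸n≡m (suc b) d)) (sym eq)
unitGapsU≡unitSteps k u d []      = refl
unitGapsU≡unitSteps k u d (U ∷ p) = unitGapsU≡unitSteps (suc k) u d p
unitGapsU≡unitSteps k u d (D ∷ p) = unitGapsD≡unitSteps k 0 k u d p (sym (*-identityʳ _))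
unitGapsD≡unitSteps a b e u d []      eq = trans (+-identityʳ _) (gap-head a b e u d eq)
unitGapsD≡unitSteps a b e u d (U ∷ p) eq = cong₂ _+_ (gap-head a b e u d eq) (unitGapsU≡unitSteps 1 (a + u) (suc b + d) p)
unitGapsD≡unitSteps a b e u d (D ∷ p) eq = unitGapsD≡unitSteps a (suc b) 0 u d p (sym (*-zeroʳ (isOne a)))

pre : Point → Point
pre (u , d) = u ∸ 1 , d ∸ 1

isOne-≢1 : ∀ {n} → n ≢ 1 → isOne n ≡ 0
isOne-≢1 {zero}        _   = refl
isOne-≢1 {suc zero}    n≢1 = contradiction refl n≢1
isOne-≢1 {suc (suc n)} _   = refl

unit-gap-yes : ∀ u d → isOne (suc u ∸ u) * isOne (suc d ∸ d) ≡ 1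
unit-gap-yes u d rewrite m+n∸n≡m 1 u | m+n∸n≡m 1 d = refl

unit-gap-no : ∀ {u d u′ d′} → u < u′ → d < d′ → pre (u′ , d′) ≢ (u , d) →
              isOne (u′ ∸ u) * isOne (d′ ∸ d) ≡ 0
unit-gap-no {u} {d} {suc u′} {suc d′} a b ne with suc u′ ∸ u ≟ 1 | suc d′ ∸ d ≟ 1
... | no  x | _     = cong (_* isOne (suc d′ ∸ d)) (isOne-≢1 x)
... | yes _ | no  y = trans (cong (isOne (suc u′ ∸ u) *_) (isOne-≢1 y)) (*-zeroʳ (isOne (suc u′ ∸ u)))
... | yes x | yes y = contradiction (cong₂ _,_ (pred≡ a x) (pred≡ b y)) ne
  where
  pred≡ : ∀ {x y} → x < suc y → suc y ∸ x ≡ 1 → y ≡ x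
  pred≡ {x} {y} x<y e = suc-injective (trans (sym (m∸n+n≡m (<⇒≤ x<y))) (cong (_+ x) e))

-- In a strict chain the diagonal predecessor of a point can only be the point immediately before
-- it, so membership in the whole chain is a condition on single gaps.
length-filter-pre : ∀ {N} {Q : Pred Point 0ℓ} (Q? : Decidable Q) v L → Chain N v L →
                    (∀ {w} → w ∈ L → Q w → pre w ∈ v ∷ L) →
                    (∀ {w} → w ∈ L → pre w ∈ v ∷ L → Q w) →
                    length (filter Q? L) ≡ unitGaps v L
length-filter-pre Q? v [] _ to from = refl
length-filter-pre {Q = Q} Q? (u , d) ((u′ , d′) ∷ L) ((a , b , _) ∷ c) to from with Q? (u′ , d′)
  | length-filter-pre Q? (u′ , d′) L c to′ (λ w∈ pw∈ → from (there w∈) (there pw∈))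
  where
  to′ : ∀ {w} → w ∈ L → Q w → pre w ∈ (u′ , d′) ∷ L
  to′ w∈ q with to (there w∈) q
  ... | there pw∈ = pw∈
  -- If `pre w` were the point before `(u′ , d′)`, then `u′` would lie strictly between two
  -- consecutive numbers.
  ... | here refl = contradiction (<-≤-trans a (∸-monoˡ-≤ 1 (proj₁ (chain⇒< c w∈)))) (<-irrefl refl)
... | no ¬q | ih = cong₂ _+_ (sym (unit-gap-no a b (¬q ∘ from (here refl) ∘ here))) ih
... | yes q | ih = cong₂ _+_ (sym gap≡1) ih
  where
  gap≡1 : isOne (u′ ∸ u) * isOne (d′ ∸ d) ≡ 1
  gap≡1 with to (here refl) q
  ... | here refl = trans (sym (cong₂ (λ x y → isOne (x ∸ u) * isOne (y ∸ d)) (suc-pred′ a) (suc-pred′ b)))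
                          (unit-gap-yes u d)
    where
    suc-pred′ : ∀ {m n} → m < n → suc (n ∸ 1) ≡ n
    suc-pred′ (s≤s _) = refl
  ... | there (here e) = contradiction (cong proj₁ e) (<⇒≢ (n∸1<n a))
    where
    n∸1<n : ∀ {m n} → m < n → n ∸ 1 < n
    n∸1<n (s≤s _) = ≤-refl
  ... | there (there pw∈) =
    contradiction (≤-<-trans (m∸n≤m u′ 1) (proj₁ (chain⇒< c pw∈))) (<-irrefl refl)

open ≡-Reasoning

-- Generating functions

-- Summation over the ballot words of length `r` from height `h`, by recursion on the first letter
-- so that sums split by computation; `#ballots` connects it with lists.
∑ballots : ℕ → ℕ → (List Step → ℤ) → ℤ
∑ballots zero    h       g = g []
∑ballots (suc r) zero    g = ∑ballots r 1 (g ∘ (U ∷_))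
∑ballots (suc r) (suc h) g = ∑ballots r (suc (suc h)) (g ∘ (U ∷_)) ℤ.+ ∑ballots r h (g ∘ (D ∷_))

∑ballots-cong : ∀ r h {f g : List Step → ℤ} → (∀ p → f p ≡ g p) → ∑ballots r h f ≡ ∑ballots r h g
∑ballots-cong zero    h       f≗g = f≗g []
∑ballots-cong (suc r) zero    f≗g = ∑ballots-cong r 1 (f≗g ∘ (U ∷_))
∑ballots-cong (suc r) (suc h) f≗g =
  cong₂ ℤ._+_ (∑ballots-cong r (suc (suc h)) (f≗g ∘ (U ∷_))) (∑ballots-cong r h (f≗g ∘ (D ∷_)))

∑ballots-+ : ∀ r h (f g : List Step → ℤ) → ∑ballots r h f ℤ.+ ∑ballots r h g ≡ ∑ballots r h (λ p → f p ℤ.+ g p)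
∑ballots-+ zero    h       f g = refl
∑ballots-+ (suc r) zero    f g = ∑ballots-+ r 1 _ _
∑ballots-+ (suc r) (suc h) f g = trans
  (+-exchange (∑ballots r (suc (suc h)) (f ∘ (U ∷_))) _ _ _)
  (cong₂ ℤ._+_ (∑ballots-+ r (suc (suc h)) _ _) (∑ballots-+ r h _ _))

∑ballots-zero : ∀ r h → ∑ballots r h (λ _ → 0ℤ) ≡ 0ℤ
∑ballots-zero zero    h       = refl
∑ballots-zero (suc r) zero    = ∑ballots-zero r 1
∑ballots-zero (suc r) (suc h) = cong₂ ℤ._+_ (∑ballots-zero r (suc (suc h))) (∑ballots-zero r h)

-- The two parts of a sum over the words continuing a descent: those that
-- stop or turn upwards (a valley), and those that descend further.
rise fall : ℕ → ℕ → (List Step → ℤ) → ℤ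
rise zero    h g = g []
rise (suc r) h g = ∑ballots r (suc h) (g ∘ (U ∷_))
fall zero    h       g = 0ℤ
fall (suc r) zero    g = 0ℤ
fall (suc r) (suc h) g = ∑ballots r h (g ∘ (D ∷_))

∑ballots≡rise+fall : ∀ r h g → ∑ballots r h g ≡ rise r h g ℤ.+ fall r h g
∑ballots≡rise+fall zero    h       g = sym (ℤ.+-identityʳ _)
∑ballots≡rise+fall (suc r) zero    g = sym (ℤ.+-identityʳ _)
∑ballots≡rise+fall (suc r) (suc h) g = refl

rise-cong : ∀ r h {f g : List Step → ℤ} → f [] ≡ g [] → (∀ p → f (U ∷ p) ≡ g (U ∷ p)) →
            rise r h f ≡ rise r h g
rise-cong zero    h e f≗g = e
rise-cong (suc r) h e f≗g = ∑ballots-cong r (suc h) f≗g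

-- ω i m s stands for the monomial x^i z^m y^s, where y = z + 1.
module Weights (ω : ℕ → ℕ → ℕ → ℤ)
               (ω-split : ∀ i m s → ω i m s ℤ.+ ω i (suc m) s ≡ ω i m (suc s)) where

  -- Weights of the completions of a prefix of weight ω i m s, in the states
  -- of degree and defect.
  face : Step → ℕ → (i m s : ℕ) → List Step → ℤ
  face U k       i m s []      = ω (i + ⌊ k /2⌋) (m + ⌊ k /2⌋) s
  face U k       i m s (U ∷ p) = face U (suc k) i m s p
  face U k       i m s (D ∷ p) = face D (pred k) (suc i) m s p
  face D k       i m s []      = ω i m s
  face D k       i m s (U ∷ p) = face U 1 i m s p
  face D zero    i m s (D ∷ p) = face D 0 i m s p
  face D (suc k) i m s (D ∷ p) = face D k (suc i) (suc m) s p

  -- Only words of defect 0 have nonzero weight.  The first index tells whether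
  -- the current ascent has length 1 or at least 2, the second one whether the
  -- current descent has length 1 or at least 2 (written ₊).
  facet₁ facet₂ facet₁₁ facet₁₊ facet₂₁ : (i m s : ℕ) → List Step → ℤ
  facet₁ i m s []      = ω i m s
  facet₁ i m s (U ∷ p) = facet₂ i m s p
  facet₁ i m s (D ∷ p) = facet₁₁ (suc i) m s p
  facet₂ i m s []      = 0ℤ
  facet₂ i m s (U ∷ p) = facet₂ i m s p
  facet₂ i m s (D ∷ p) = facet₂₁ (suc i) m s p
  facet₁₁ i m s []      = ω i m (suc s)
  facet₁₁ i m s (U ∷ p) = facet₁ i m (suc s) p
  facet₁₁ i m s (D ∷ p) = facet₁₊ i m s p
  facet₁₊ i m s []      = ω i m s
  facet₁₊ i m s (U ∷ p) = facet₁ i m s p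
  facet₁₊ i m s (D ∷ p) = facet₁₊ i m s p
  facet₂₁ i m s []      = ω i m s
  facet₂₁ i m s (U ∷ p) = facet₁ i m s p
  facet₂₁ i m s (D ∷ p) = 0ℤ

  face-split : ∀ t k i m s p → face t k i m s p ℤ.+ face t k i (suc m) s p ≡ face t k i m (suc s) p
  face-split U k       i m s []      = ω-split (i + ⌊ k /2⌋) (m + ⌊ k /2⌋) s
  face-split U k       i m s (U ∷ p) = face-split U (suc k) i m s p
  face-split U k       i m s (D ∷ p) = face-split D (pred k) (suc i) m s p
  face-split D k       i m s []      = ω-split i m s
  face-split D k       i m s (U ∷ p) = face-split U 1 i m s p
  face-split D zero    i m s (D ∷ p) = face-split D 0 i m s p
  face-split D (suc k) i m s (D ∷ p) = face-split D k (suc i) (suc m) s p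

  -- The continuations after a gap has just been closed. On words that stop or turn upwards
  -- `face D k` does not depend on `k`, and `facet₁₊` agrees with `facet₂₁`, so one sum serves for
  -- these gaps.
  faceSum facetSum : ℕ → ℕ → (i m s : ℕ) → ℤ
  faceSum r h i m s = rise r h (face D 0 i m s)
  facetSum r h i m s = rise r h (facet₁₊ i m s)

  faceSum-split : ∀ r h i m s → faceSum r h i m s ℤ.+ faceSum r h i (suc m) s ≡ faceSum r h i m (suc s)
  faceSum-split zero    h i m s = ω-split i m s
  faceSum-split (suc r) h i m s = trans (∑ballots-+ r (suc h) _ _) (∑ballots-cong r (suc h) (face-split U 1 i m s))

  -- The words completing an ascent of length at least 2, followed by a
  -- descent of length 1.
  longAscents : ℕ → ℕ → (i m s : ℕ) → ℤ
  longAscents zero    h       i m s = 0ℤ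
  longAscents (suc r) zero    i m s = longAscents r 1 i m s
  longAscents (suc r) (suc h) i m s = longAscents r (suc (suc h)) i m s ℤ.+ faceSum r h (suc i) m s

  -- In all other completions of that ascent, a peak UD can be removed.
  cut : ℕ → ℕ → ℕ → (i m s : ℕ) → ℤ
  cut zero    h k i m s = ω (suc i + ⌊ k /2⌋) (suc m + ⌊ k /2⌋) s
  cut (suc r) h k i m s = ∑ballots r h (face U (suc k) (suc i) (suc m) s)

  -- The factor x z in `cut` is the one that the second D of the descent contributes, so the words
  -- that descend further already carry it.
  cut-suc : ∀ r h k i m s →
            cut r (suc h) (suc k) i m s ℤ.+ fall r h (face D (suc k) (suc i) m s)
            ≡ cut (suc r) h k i m s
  cut-suc zero    h       k i m s = ℤ.+-identityʳ _
  cut-suc (suc r) zero    k i m s = ℤ.+-identityʳ _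
  cut-suc (suc r) (suc h) k i m s = refl

  ∑ballots-face₂ : ∀ r h k i m s →
             ∑ballots r (suc h) (face U (suc (suc k)) i m s) ≡ longAscents r (suc h) i m s ℤ.+ cut r h k i m s
  -- A final ascent loses two letters U instead of a peak, with the same factor x z.
  ∑ballots-face₂ zero    h k i m s = trans (cong₂ (λ a b → ω a b s) (+-suc i _) (+-suc m _))
                                     (sym (ℤ.+-identityˡ _))
  ∑ballots-face₂ (suc r) h k i m s = begin
    ∑ballots r (suc (suc h)) (face U (3+k) i m s) ℤ.+ ∑ballots r h (face D (suc k) (suc i) m s)
      ≡⟨ cong₂ ℤ._+_ (∑ballots-face₂ r (suc h) (suc k) i m s) (∑ballots≡rise+fall r h _) ⟩
    (longAscents r (suc (suc h)) i m s ℤ.+ cut r (suc h) (suc k) i m s) ℤ.+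
    (rise r h (face D (suc k) (suc i) m s) ℤ.+ fall r h (face D (suc k) (suc i) m s))
      ≡⟨ +-exchange (longAscents r (suc (suc h)) i m s) _ _ _ ⟩
    (longAscents r (suc (suc h)) i m s ℤ.+ rise r h (face D (suc k) (suc i) m s)) ℤ.+
    (cut r (suc h) (suc k) i m s ℤ.+ fall r h (face D (suc k) (suc i) m s))
      ≡⟨ cong₂ (λ a b → (longAscents r (suc (suc h)) i m s ℤ.+ a) ℤ.+ b)
               (rise-cong r h refl (λ _ → refl)) (cut-suc r h k i m s) ⟩
    longAscents (suc r) (suc h) i m s ℤ.+ cut (suc r) h k i m s ∎
    where
    3+k = suc (suc (suc k))

  -- An ascent of two letters has one left after the cut, which is how an arbitrary continuation
  -- upwards from a valley begins.
  cut≡faceSum : ∀ r h i m s → cut r (suc h) 0 i m s ≡ faceSum r h (suc i) (suc m) s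
  cut≡faceSum zero    h i m s = cong₂ (λ a b → ω a b s) (+-identityʳ (suc i)) (+-identityʳ (suc m))
  cut≡faceSum (suc r) h i m s = refl

  facetSum≡∑facet₂₁ : ∀ r h i m s → facetSum r h i m s ≡ ∑ballots r h (facet₂₁ i m s)
  facetSum≡∑facet₂₁ zero    h       i m s = refl
  facetSum≡∑facet₂₁ (suc r) zero    i m s = refl
  facetSum≡∑facet₂₁ (suc r) (suc h) i m s =
    trans (sym (ℤ.+-identityʳ _)) (cong (λ z → facetSum (suc r) (suc h) i m s ℤ.+ z) (sym (∑ballots-zero r h)))

  -- Four statements by simultaneous induction on `r`. In the main one, the cut words (x z F) and
  -- the first gap (1 , 1) (x F) combine by `faceSum-split` to x y F, the value of `facet₁₁` at a
  -- valley. Long ascents followed by a single D, and an ascent of length 1 followed by a longer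
  -- descent, keep their first factor and are handled by the other three.
  faceSum≡facetSum : ∀ r h i m s → faceSum r h i m s ≡ facetSum r h i m s
  longAscents≡∑facet₂ : ∀ r h i m s → longAscents r h i m s ≡ ∑ballots r h (facet₂ i m s)
  ∑face≡∑facet₁₊ : ∀ r h i m s → ∑ballots r h (face D 0 i m s) ≡ ∑ballots r h (facet₁₊ i m s)
  facetSum+fall≡∑facet₁₁ : ∀ r h i m s → facetSum r h i m (suc s) ℤ.+ fall r h (face D 0 i m s) ≡ ∑ballots r h (facet₁₁ i m s)

  faceSum≡facetSum zero          h i m s = refl
  faceSum≡facetSum (suc zero)    h i m s = cong₂ (λ a b → ω a b s) (+-identityʳ i) (+-identityʳ m)
  faceSum≡facetSum (suc (suc r)) h i m s = begin
    ∑ballots r (suc (suc h)) (face U 2 i m s) ℤ.+ ∑ballots r h (face D 0 (suc i) m s)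
      ≡⟨ cong₂ ℤ._+_ (trans (∑ballots-face₂ r (suc h) 0 i m s) (ℤ.+-comm (longAscents r (suc (suc h)) i m s) _))
                     (∑ballots≡rise+fall r h _) ⟩
    (cut r (suc h) 0 i m s ℤ.+ longAscents r (suc (suc h)) i m s) ℤ.+ (faceSum r h (suc i) m s ℤ.+ fall₀)
      ≡⟨ +-exchange (cut r (suc h) 0 i m s) _ _ _ ⟩
    (cut r (suc h) 0 i m s ℤ.+ faceSum r h (suc i) m s) ℤ.+ (longAscents r (suc (suc h)) i m s ℤ.+ fall₀)
      ≡⟨ cong₂ ℤ._+_ cut+faceSum (cong (ℤ._+ fall₀) (longAscents≡∑facet₂ r (suc (suc h)) i m s)) ⟩
    facetSum r h (suc i) m (suc s) ℤ.+ (∑₂ ℤ.+ fall₀)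
      ≡⟨ x∙yz≈y∙xz (facetSum r h (suc i) m (suc s)) ∑₂ fall₀ ⟩
    ∑₂ ℤ.+ (facetSum r h (suc i) m (suc s) ℤ.+ fall₀)
      ≡⟨ cong (λ z → ∑₂ ℤ.+ z) (facetSum+fall≡∑facet₁₁ r h (suc i) m s) ⟩
    ∑₂ ℤ.+ ∑ballots r h (facet₁₁ (suc i) m s) ∎
    where
    fall₀ ∑₂ : ℤ
    fall₀ = fall r h (face D 0 (suc i) m s)
    ∑₂ = ∑ballots r (suc (suc h)) (facet₂ i m s)

    cut+faceSum : cut r (suc h) 0 i m s ℤ.+ faceSum r h (suc i) m s ≡ facetSum r h (suc i) m (suc s)
    cut+faceSum = begin
      cut r (suc h) 0 i m s ℤ.+ faceSum r h (suc i) m s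
        ≡⟨ cong (ℤ._+ faceSum r h (suc i) m s) (cut≡faceSum r h i m s) ⟩
      faceSum r h (suc i) (suc m) s ℤ.+ faceSum r h (suc i) m s
        ≡⟨ ℤ.+-comm (faceSum r h (suc i) (suc m) s) _ ⟩
      faceSum r h (suc i) m s ℤ.+ faceSum r h (suc i) (suc m) s
        ≡⟨ faceSum-split r h (suc i) m s ⟩
      faceSum r h (suc i) m (suc s)
        ≡⟨ faceSum≡facetSum r h (suc i) m (suc s) ⟩
      facetSum r h (suc i) m (suc s) ∎

  facetSum+fall≡∑facet₁₁ zero    h       i m s = ℤ.+-identityʳ _
  facetSum+fall≡∑facet₁₁ (suc r) zero    i m s = ℤ.+-identityʳ _
  facetSum+fall≡∑facet₁₁ (suc r) (suc h) i m s = cong (λ z → facetSum (suc r) (suc h) i m (suc s) ℤ.+ z) (∑face≡∑facet₁₊ r h i m s)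

  longAscents≡∑facet₂ zero    h       i m s = refl
  longAscents≡∑facet₂ (suc r) zero    i m s = longAscents≡∑facet₂ r 1 i m s
  longAscents≡∑facet₂ (suc r) (suc h) i m s = cong₂ ℤ._+_ (longAscents≡∑facet₂ r (suc (suc h)) i m s) (trans (faceSum≡facetSum r h (suc i) m s) (facetSum≡∑facet₂₁ r h (suc i) m s))

  ∑face≡∑facet₁₊ zero    h       i m s = refl
  ∑face≡∑facet₁₊ (suc r) zero    i m s = faceSum≡facetSum (suc r) 0 i m s
  ∑face≡∑facet₁₊ (suc r) (suc h) i m s = cong₂ ℤ._+_ (faceSum≡facetSum (suc r) (suc h) i m s) (∑face≡∑facet₁₊ r h i m s)

when : ℕ → ℤ → ℤ
when zero    z = z
when (suc _) z = 0ℤ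

module _ (ω : ℕ → ℕ → ℕ → ℤ)
         (ω-split : ∀ i m s → ω i m s ℤ.+ ω i (suc m) s ≡ ω i m (suc s)) where
  open Weights ω ω-split

  face≡ω : ∀ t k i m s p → face t k i m s p ≡ ω (degree t k p + i) (defect t k p + m) s
  face≡ω U k       i m s []      = cong₂ (λ a b → ω a b s) (+-comm i _) (+-comm m _)
  face≡ω U k       i m s (U ∷ p) = face≡ω U (suc k) i m s p
  face≡ω U k       i m s (D ∷ p) = trans (face≡ω D (pred k) (suc i) m s p) (cong (λ a → ω a (defect D (pred k) p + m) s) (+-suc _ i))
  face≡ω D k       i m s []      = refl
  face≡ω D k       i m s (U ∷ p) = face≡ω U 1 i m s p
  face≡ω D zero    i m s (D ∷ p) = face≡ω D 0 i m s p
  face≡ω D (suc k) i m s (D ∷ p) =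
    trans (face≡ω D k (suc i) (suc m) s p) (cong₂ (λ a b → ω a b s) (+-suc _ i) (+-suc _ m))

  -- Two state numbers are needed: `k` is the truncated difference for `degree` and `defect`, `e`
  -- the test for a gap (1 , 1) in `unitSteps`. After the gap (1 , 1) they are 0 and 1, after (1 ,
  -- b) with b at least 2 both are 0.
  facetWeight : Step → ℕ → ℕ → (i m s : ℕ) → List Step → ℤ
  facetWeight t k e i m s p = when (defect t k p) (ω (degree t k p + i) m (unitSteps t e p + s))

  facet₁≡  : ∀ i m s p → facet₁ i m s p ≡ facetWeight U 1 1 i m s p
  facet₂≡  : ∀ k i m s p → facet₂ i m s p ≡ facetWeight U (suc (suc k)) (suc (suc k)) i m s p
  facet₁₁≡ : ∀ i m s p → facet₁₁ i m s p ≡ facetWeight D 0 1 i m s p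
  facet₁₊≡ : ∀ i m s p → facet₁₊ i m s p ≡ facetWeight D 0 0 i m s p
  facet₂₁≡ : ∀ k i m s p → facet₂₁ i m s p ≡ facetWeight D (suc k) (suc (suc k)) i m s p

  facet₁≡ i m s []      = refl
  facet₁≡ i m s (U ∷ p) = facet₂≡ 0 i m s p
  facet₁≡ i m s (D ∷ p) = trans (facet₁₁≡ (suc i) m s p) (cong (λ a → when (defect D 0 p) (ω a m (unitSteps D 1 p + s))) (+-suc _ i))
  facet₂≡ k i m s []      = refl
  facet₂≡ k i m s (U ∷ p) = facet₂≡ (suc k) i m s p
  facet₂≡ k i m s (D ∷ p) = trans (facet₂₁≡ k (suc i) m s p) (cong (λ a → when (defect D (suc k) p) (ω a m (unitSteps D (suc (suc k)) p + s))) (+-suc _ i))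
  facet₁₁≡ i m s []      = refl
  facet₁₁≡ i m s (U ∷ p) = trans (facet₁≡ i m (suc s) p) (cong (λ a → when (defect U 1 p) (ω (degree U 1 p + i) m a)) (+-suc _ s))
  facet₁₁≡ i m s (D ∷ p) = facet₁₊≡ i m s p
  facet₁₊≡ i m s []      = refl
  facet₁₊≡ i m s (U ∷ p) = facet₁≡ i m s p
  facet₁₊≡ i m s (D ∷ p) = facet₁₊≡ i m s p
  facet₂₁≡ k i m s []      = refl
  facet₂₁≡ k i m s (U ∷ p) = facet₁≡ i m s p
  facet₂₁≡ k i m s (D ∷ p) = refl

  ∑-faces≡∑-facets : ∀ r → ∑ballots r 1 (λ p → ω (degree U 1 p) (defect U 1 p) 0)
                         ≡ ∑ballots r 1 (λ p → when (defect U 1 p) (ω (degree U 1 p) 0 (unitSteps U 1 p)))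
  ∑-faces≡∑-facets r = trans
    (∑ballots-cong r 1 λ p → sym (trans (face≡ω U 1 0 0 0 p) (cong₂ (λ a b → ω a b 0) (+-identityʳ _) (+-identityʳ _))))
    -- The origin plays the part of a valley at height 0, and the first U is the letter that `rise`
    -- reads.
    (trans (faceSum≡facetSum (suc r) 0 0 0 0)
    (∑ballots-cong r 1 λ p → trans (facet₁≡ 0 0 0 p) (cong₂ (λ a b → when (defect U 1 p) (ω a 0 b)) (+-identityʳ _) (+-identityʳ _))))

-- Symmetric Dyck paths and their halves

prefixes⇒ballot : ∀ h l → All (λ q → (# D) q ≤ h + (# U) q) (inits l) → Ballot h l
prefixes⇒ballot h [] _ = h , []
prefixes⇒ballot h (U ∷ l) (_ ∷ qs) =
  ballot-up (prefixes⇒ballot (suc h) l (All.map (λ {q} → subst ((# D) q ≤_) (+-suc h _)) (All.map⁻ qs)))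
prefixes⇒ballot zero    (D ∷ l) (_ ∷ () ∷ _)
prefixes⇒ballot (suc h) (D ∷ l) (_ ∷ qs) =
  ballot-down (prefixes⇒ballot h l (All.map s≤s⁻¹ (All.map⁻ qs)))

path⇒prefixes : ∀ {h l e} → Path h l e → All (λ q → (# D) q ≤ h + (# U) q) (inits l)
path⇒prefixes []       = z≤n ∷ []
path⇒prefixes (up {h} π) = z≤n ∷ All.map⁺ (All.map (λ {q} → subst ((# D) q ≤_) (sym (+-suc h _))) (path⇒prefixes π))
path⇒prefixes (down π) = z≤n ∷ All.map⁺ (All.map s≤s (path⇒prefixes π))

path-count : ∀ {h l e} → Path h l e → e + (# D) l ≡ h + (# U) l
path-count [] = refl
path-count (up {h} {p} π) = trans (path-count π) (sym (+-suc h _))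
path-count (down {h} {p} {e} π) = trans (+-suc e _) (cong suc (path-count π))

isDyck⇒path : ∀ {m} (w : Vec Step (2 * m)) → IsDyck {m} w → Path 0 (toList w) 0
isDyck⇒path w (eq , qs) with prefixes⇒ballot 0 (toList w) qs
... | e , π with +-cancelʳ-≡ ((# D) (toList w)) e 0 (trans (path-count π) eq)
... | refl = π

path⇒isDyck : ∀ {m} (w : Vec Step (2 * m)) → Path 0 (toList w) 0 → IsDyck {m} w
path⇒isDyck w π = sym (path-count π) , path⇒prefixes π

path-++ : ∀ {h p e q e′} → Path h p e → Path e q e′ → Path h (p ++ q) e′
path-++ []       ρ = ρ
path-++ (up π)   ρ = up (path-++ π ρ)
path-++ (down π) ρ = down (path-++ π ρ)

path-prefix : ∀ {h} p {q e} → Path h (p ++ q) e → Ballot h p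
path-prefix []      π        = _ , []
path-prefix (U ∷ p) (up π)   = ballot-up (path-prefix p π)
path-prefix (D ∷ p) (down π) = ballot-down (path-prefix p π)

mirror : List Step → List Step
mirror p = map flip (reverse p)

mirror-∷ : ∀ s p → mirror (s ∷ p) ≡ mirror p ++ flip s ∷ []
mirror-∷ s p = trans (cong (map flip) (List.unfold-reverse s p)) (List.map-++ flip (reverse p) _)

path-mirror : ∀ {h p e} → Path h p e → Path e (mirror p) h
path-mirror [] = []
path-mirror (up {p = p} π)   = subst (λ q → Path _ q _) (sym (mirror-∷ U p)) (path-++ (path-mirror π) (down []))
path-mirror (down {p = p} π) = subst (λ q → Path _ q _) (sym (mirror-∷ D p)) (path-++ (path-mirror π) (up []))

lookup-∷ʳ-last : ∀ {A : Set} {n} (v : Vec A n) x → lookup (v Vec.∷ʳ x) (Fin.fromℕ n) ≡ x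
lookup-∷ʳ-last Vec.[]      x = refl
lookup-∷ʳ-last (y Vec.∷ v) x = lookup-∷ʳ-last v x

lookup-∷ʳ-init : ∀ {A : Set} {n} (v : Vec A n) x i → lookup (v Vec.∷ʳ x) (Fin.inject₁ i) ≡ lookup v i
lookup-∷ʳ-init (y Vec.∷ v) x Fin.zero    = refl
lookup-∷ʳ-init (y Vec.∷ v) x (Fin.suc i) = lookup-∷ʳ-init v x i

lookup-reverse-opposite : ∀ {A : Set} {n} (v : Vec A n) i → lookup (Vec.reverse v) (opposite i) ≡ lookup v i
lookup-reverse-opposite (x Vec.∷ v) Fin.zero =
  trans (cong (λ z → lookup z (Fin.fromℕ _)) (Vec.reverse-∷ x v)) (lookup-∷ʳ-last (Vec.reverse v) x)
lookup-reverse-opposite (x Vec.∷ v) (Fin.suc i) =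
  trans (cong (λ z → lookup z (Fin.inject₁ (opposite i))) (Vec.reverse-∷ x v))
    (trans (lookup-∷ʳ-init (Vec.reverse v) x (opposite i)) (lookup-reverse-opposite v i))

lookup-opposite : ∀ {A : Set} {n} (v : Vec A n) i → lookup v (opposite i) ≡ lookup (Vec.reverse v) i
lookup-opposite v i = trans (sym (lookup-reverse-opposite v (opposite i)))
  (cong (lookup (Vec.reverse v)) (Fin.opposite-involutive i))

isSymmetric⇒reverse : ∀ {m} (w : Vec Step (2 * m)) → IsSymmetric {m} w → reverse (toList w) ≡ map flip (toList w)
isSymmetric⇒reverse w sym-w = trans (sym (Vec.toList-reverse w)) (trans (cong toList vec-eq) (Vec.toList-map flip w))
  where
  vec-eq : Vec.reverse w ≡ Vec.map flip w
  vec-eq = trans (sym (Vec.tabulate∘lookup _)) (trans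
    (Vec.tabulate-cong (λ i → trans (sym (lookup-opposite w i)) (trans (sym-w i) (sym (Vec.lookup-map i flip w)))))
    (Vec.tabulate∘lookup _))

toList-inj : ∀ {A : Set} {n} (v w : Vec A n) → toList v ≡ toList w → v ≡ w
toList-inj v w e = trans (sym (Vec.cast-is-id refl v)) (Vec.toList-injective refl v w e)

reverse⇒isSymmetric : ∀ {m} (w : Vec Step (2 * m)) → reverse (toList w) ≡ map flip (toList w) → IsSymmetric {m} w
reverse⇒isSymmetric w e i = trans (lookup-opposite w i) (trans (cong (λ z → lookup z i) vec-eq) (Vec.lookup-map i flip w))
  where
  vec-eq : Vec.reverse w ≡ Vec.map flip w
  vec-eq = toList-inj _ _ (trans (Vec.toList-reverse w) (trans e (sym (Vec.toList-map flip w))))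

flip-flip : ∀ s → flip (flip s) ≡ s
flip-flip U = refl
flip-flip D = refl

map-flip-flip : ∀ l → map flip (map flip l) ≡ l
map-flip-flip l = trans (sym (List.map-∘ l)) (trans (List.map-cong flip-flip l) (List.map-id l))

++-injectiveʳ : ∀ {A : Set} (p p′ : List A) {q q′} → length p ≡ length p′ → p ++ q ≡ p′ ++ q′ → q ≡ q′
++-injectiveʳ []      []        _ e = e
++-injectiveʳ (x ∷ p) (y ∷ p′) l e = ++-injectiveʳ p p′ (suc-injective l) (List.∷-injectiveʳ e)

symmetric⇒mirror : ∀ p q → length p ≡ length q → reverse (p ++ q) ≡ map flip (p ++ q) → q ≡ mirror p
symmetric⇒mirror p q l e = trans (sym (map-flip-flip q)) (cong (map flip) (sym
  (++-injectiveʳ (reverse q) (map flip p)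
    (trans (List.length-reverse q) (trans (sym l) (sym (List.length-map flip p))))
    (trans (sym (List.reverse-++ p q)) (trans e (List.map-++ flip p q))))))

mirror⇒symmetric : ∀ p → reverse (p ++ mirror p) ≡ map flip (p ++ mirror p)
mirror⇒symmetric p = begin
  reverse (p ++ mirror p)          ≡⟨ List.reverse-++ p (mirror p) ⟩
  reverse (mirror p) ++ reverse p  ≡⟨ cong₂ _++_ (trans (sym (List.reverse-map flip (reverse p)))
                                       (cong (map flip) (List.reverse-involutive p))) (sym (map-flip-flip (reverse p))) ⟩
  map flip p ++ map flip (mirror p) ≡⟨ List.map-++ flip p (mirror p) ⟨
  map flip (p ++ mirror p)         ∎

half : ∀ {k} → ℕ → Vec Step k → List Step
half m w = take m (toList w)

-- A relation rather than the function `half`, so that it applies equally to the half of a given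
-- path and to a constructed ballot word such as a filling.
record HalfOf (m : ℕ) (w : Vec Step (2 * m)) (p : List Step) : Set where
  field
    word≡  : toList w ≡ p ++ mirror p
    length≡ : length p ≡ m
    ballot : Ballot 0 p
open HalfOf

∈-words : ∀ {k} (w : Vec Step k) → w ∈ words k
∈-words Vec.[]      = here refl
∈-words (U Vec.∷ w) = ∈-cartesianProductWith⁺ Vec._∷_ {xs = U ∷ D ∷ []} (here refl) (∈-words w)
∈-words (D Vec.∷ w) = ∈-cartesianProductWith⁺ Vec._∷_ {xs = U ∷ D ∷ []} (there (here refl)) (∈-words w)

words-unique : ∀ k → Unique (words k)
words-unique zero    = [] ∷ []
words-unique (suc k) = Unique.cartesianProductWith⁺ Vec._∷_ (λ { refl → refl , refl })
  (((λ ()) ∷ []) ∷ [] ∷ []) (words-unique k)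

SDyck-unique : ∀ m → Unique (SDyck m)
SDyck-unique m = Unique.filter⁺ _ (words-unique (2 * m))

∈-SDyck⁻ : ∀ m {w} → w ∈ SDyck m → HalfOf m w (half m w)
∈-SDyck⁻ m {w} w∈ with ∈-filter⁻ _ {xs = words (2 * m)} w∈
... | _ , isDyck , isSym = record { word≡ = eq ; length≡ = len-p ; ballot = path-prefix p (subst (λ l → Path 0 l 0) (sym split) (isDyck⇒path {m} w isDyck)) }
  where
  l p q : List Step
  l = toList w
  p = take m l
  q = drop m l
  split : p ++ q ≡ l
  split = List.take++drop≡id m l
  len-l : length l ≡ m + m
  len-l = trans (Vec.length-toList w) (cong (λ k → m + k) (+-identityʳ m))
  len-p : length p ≡ m
  len-p = trans (List.length-take m l) (m≤n⇒m⊓n≡m (subst (m ≤_) (sym len-l) (m≤m+n m m)))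
  len-q : length q ≡ m
  len-q = trans (List.length-drop m l) (trans (cong (_∸ m) len-l) (m+n∸n≡m m m))
  eq : l ≡ p ++ mirror p
  eq = trans (sym split) (cong (p ++_) (symmetric⇒mirror p q (trans len-p (sym len-q))
    (subst (λ l → reverse l ≡ map flip l) (sym split) (isSymmetric⇒reverse {m} w isSym))))

∈-SDyck⁺ : ∀ m {w p} → HalfOf m w p → w ∈ SDyck m
∈-SDyck⁺ m {w} {p} H = ∈-filter⁺ _ (∈-words w) (path⇒isDyck {m} w path , reverse⇒isSymmetric {m} w
  (subst (λ l → reverse l ≡ map flip l) (sym (word≡ H)) (mirror⇒symmetric p)))
  where
  path : Path 0 (toList w) 0
  path = subst (λ l → Path 0 l 0) (sym (word≡ H)) (path-++ (proj₂ (ballot H)) (path-mirror (proj₂ (ballot H))))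

take-length-++ : ∀ {A : Set} (p q : List A) → take (length p) (p ++ q) ≡ p
take-length-++ []      q = refl
take-length-++ (x ∷ p) q = cong (x ∷_) (take-length-++ p q)

half≡ : ∀ m {w p} → HalfOf m w p → half m w ≡ p
half≡ m {w} {p} H = trans (cong₂ take (sym (length≡ H)) (word≡ H)) (take-length-++ p (mirror p))

fromHalf : ∀ m p → length p ≡ m → Ballot 0 p → ∃ λ w → HalfOf m w p
fromHalf m p len b = Vec.cast eq (Vec.fromList (p ++ mirror p)) , record
  { word≡ = trans (Vec.toList-cast eq _) (Vec.toList∘fromList (p ++ mirror p)) ; length≡ = len ; ballot = b }
  where
  eq : length (p ++ mirror p) ≡ 2 * m
  eq = trans (List.length-++ p) (cong₂ _+_ len (trans (trans (List.length-map flip (reverse p))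
       (trans (List.length-reverse p) len)) (sym (+-identityʳ m))))

unique-↭ : ∀ {A : Set} {xs ys : List A} → Unique xs → Unique ys →
           (∀ {z} → z ∈ xs → z ∈ ys) → (∀ {z} → z ∈ ys → z ∈ xs) → xs ↭ ys
unique-↭ u v f g = ∼bag⇒↭ (unique∧set⇒bag u v (mk⇔ f g))

unique⇒allPairs : ∀ {A : Set} {R : A → A → Set} {xs} → Unique xs →
                  (∀ {x y} → x ∈ xs → y ∈ xs → x ≢ y → R x y) → AllPairs R xs
unique⇒allPairs []       r = []
unique⇒allPairs (x∉ ∷ u) r =
  All.tabulate (λ y∈ → r (here refl) (there y∈) (All.lookup x∉ y∈)) ∷
  unique⇒allPairs u (λ x∈ y∈ → r (there x∈) (there y∈))

ballots : ℕ → ℕ → List (List Step)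
ballots zero    h       = [] ∷ []
ballots (suc r) zero    = map (U ∷_) (ballots r 1)
ballots (suc r) (suc h) = map (U ∷_) (ballots r (suc (suc h))) ++ map (D ∷_) (ballots r h)

∈-ballots⁺ : ∀ {h p} → Ballot h p → p ∈ ballots (length p) h
∈-ballots⁺ (_ , [])               = here refl
∈-ballots⁺ (_ , up {zero} π)      = ∈-map⁺ (U ∷_) (∈-ballots⁺ (_ , π))
∈-ballots⁺ (_ , up {suc h} π)     = ∈-++⁺ˡ (∈-map⁺ (U ∷_) (∈-ballots⁺ (_ , π)))
∈-ballots⁺ (_ , down {h} {p} π)   =
  ∈-++⁺ʳ (map (U ∷_) (ballots (length p) (suc (suc h)))) (∈-map⁺ (D ∷_) (∈-ballots⁺ (_ , π)))

∈-ballots⁻ : ∀ r h {p} → p ∈ ballots r h → Ballot h p × length p ≡ r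
∈-ballots⁻ zero h (here refl) = (_ , []) , refl
∈-ballots⁻ (suc r) zero p∈ with ∈-map⁻ (U ∷_) p∈
... | q , q∈ , refl with ∈-ballots⁻ r 1 q∈
... | b , e = ballot-up b , cong suc e
∈-ballots⁻ (suc r) (suc h) p∈ with ∈-++⁻ (map (U ∷_) (ballots r (suc (suc h)))) p∈
... | inj₁ p∈U with ∈-map⁻ (U ∷_) p∈U
... | q , q∈ , refl with ∈-ballots⁻ r (suc (suc h)) q∈
... | b , e = ballot-up b , cong suc e
∈-ballots⁻ (suc r) (suc h) p∈ | inj₂ p∈D with ∈-map⁻ (D ∷_) p∈D
... | q , q∈ , refl with ∈-ballots⁻ r h q∈
... | b , e = ballot-down b , cong suc e

ballots-unique : ∀ r h → Unique (ballots r h)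
ballots-unique zero    h       = [] ∷ []
ballots-unique (suc r) zero    = Unique.map⁺ List.∷-injectiveʳ (ballots-unique r 1)
ballots-unique (suc r) (suc h) = Unique.++⁺
  (Unique.map⁺ List.∷-injectiveʳ (ballots-unique r (suc (suc h))))
  (Unique.map⁺ List.∷-injectiveʳ (ballots-unique r h))
  λ (p∈U , p∈D) → U≢D (∈-map⁻ (U ∷_) p∈U) (∈-map⁻ (D ∷_) p∈D)
  where
  U≢D : ∀ {p} {ps qs : List (List Step)} → (∃ λ q → q ∈ ps × p ≡ U ∷ q) → (∃ λ q → q ∈ qs × p ≡ D ∷ q) → ⊥
  U≢D (_ , _ , refl) (_ , _ , ())

half-injective : ∀ m {v w} → v ∈ SDyck m → w ∈ SDyck m → half m v ≡ half m w → v ≡ w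
half-injective m {v} {w} v∈ w∈ e = toList-inj v w (trans (word≡ (∈-SDyck⁻ m v∈))
  (trans (cong (λ p → p ++ mirror p) e) (sym (word≡ (∈-SDyck⁻ m w∈)))))

-- A symmetric path is determined by its first half, and every ballot word `p` of length `m`,
-- whatever its end height, is completed by `mirror p`.
map-half-SDyck : ∀ m → map (half m) (SDyck m) ↭ ballots m 0
map-half-SDyck m = unique-↭
  (AllPairs.map⁺ (unique⇒allPairs (SDyck-unique m) λ v∈ w∈ v≢w e → v≢w (half-injective m v∈ w∈ e)))
  (ballots-unique m 0) to from
  where
  to : ∀ {p} → p ∈ map (half m) (SDyck m) → p ∈ ballots m 0
  to p∈ with ∈-map⁻ (half m) p∈
  ... | w , w∈ , refl = subst (λ r → half m w ∈ ballots r 0) (length≡ H) (∈-ballots⁺ (ballot H))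
    where
    H : HalfOf m w (half m w)
    H = ∈-SDyck⁻ m w∈
  from : ∀ {p} → p ∈ ballots m 0 → p ∈ map (half m) (SDyck m)
  from {p} p∈ with ∈-ballots⁻ m 0 p∈
  ... | b , e with fromHalf m p e b
  ... | w , H = subst (_∈ map (half m) (SDyck m)) (half≡ m H) (∈-map⁺ (half m) (∈-SDyck⁺ m H))

-- Valleys as positions

letterAt : List Step → ℕ → Maybe Step
letterAt l i = head (drop i l)

lastOf : Step → List Step → Step
lastOf t []      = t
lastOf t (s ∷ p) = lastOf s p

-- Position in w of the valley at index x of the word t ∷ p ++ q, whose first
-- letter t is preceded by u letters U and d letters D, t included.
record ValleyAt (t : Step) (u d : ℕ) (p q : List Step) (z : Point) : Set where
  constructor valleyAt
  field
    x   : ℕ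
    x≤  : x ≤ length p
    atD : letterAt (t ∷ p ++ q) x ≡ just D
    atU : letterAt (t ∷ p ++ q) (suc x) ≡ just U
    z≡  : z ≡ (u + (# U) (take x (p ++ q)) , d + (# D) (take x (p ++ q)))

shift-U⁺ : ∀ t u d p q {z} → ValleyAt U (suc u) d p q z → ValleyAt t u d (U ∷ p) q z
shift-U⁺ t u d p q (valleyAt x x≤ a b z≡) =
  valleyAt (suc x) (s≤s x≤) a b (trans z≡ (cong₂ _,_ (sym (+-suc u _)) refl))

shift-D⁺ : ∀ t u d p q {z} → ValleyAt D u (suc d) p q z → ValleyAt t u d (D ∷ p) q z
shift-D⁺ t u d p q (valleyAt x x≤ a b z≡) =
  valleyAt (suc x) (s≤s x≤) a b (trans z≡ (cong₂ _,_ refl (sym (+-suc d _))))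

-- The hypothesis on `head q` holds for the mirror image: the letter after the middle is opposite to
-- the one before it.
∈-valleys⁻ : ∀ t u d p q {z} → head q ≡ just (flip (lastOf t p)) →
             z ∈ valleys t u d p → ValleyAt t u d p q z
∈-valleys⁻ D u d []      (_ ∷ q) e (here refl) =
  valleyAt 0 z≤n refl e (sym (cong₂ _,_ (+-identityʳ u) (+-identityʳ d)))
∈-valleys⁻ U u d (U ∷ p) q e z∈ = shift-U⁺ U u d p q (∈-valleys⁻ U (suc u) d p q e z∈)
∈-valleys⁻ U u d (D ∷ p) q e z∈ = shift-D⁺ U u d p q (∈-valleys⁻ D u (suc d) p q e z∈)
∈-valleys⁻ D u d (U ∷ p) q e (here refl) =
  valleyAt 0 z≤n refl refl (sym (cong₂ _,_ (+-identityʳ u) (+-identityʳ d)))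
∈-valleys⁻ D u d (U ∷ p) q e (there z∈) = shift-U⁺ D u d p q (∈-valleys⁻ U (suc u) d p q e z∈)
∈-valleys⁻ D u d (D ∷ p) q e z∈ = shift-D⁺ D u d p q (∈-valleys⁻ D u (suc d) p q e z∈)

shift-U⁻ : ∀ u d p q {z} x → suc x ≤ length (U ∷ p) → letterAt (U ∷ p ++ q) x ≡ just D →
           letterAt (U ∷ p ++ q) (suc x) ≡ just U →
           z ≡ (u + (# U) (take (suc x) (U ∷ p ++ q)) , d + (# D) (take (suc x) (U ∷ p ++ q))) →
           ValleyAt U (suc u) d p q z
shift-U⁻ u d p q x (s≤s x≤) a b z≡ = valleyAt x x≤ a b (trans z≡ (cong₂ _,_ (+-suc u _) refl))

shift-D⁻ : ∀ u d p q {z} x → suc x ≤ length (D ∷ p) → letterAt (D ∷ p ++ q) x ≡ just D →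
           letterAt (D ∷ p ++ q) (suc x) ≡ just U →
           z ≡ (u + (# U) (take (suc x) (D ∷ p ++ q)) , d + (# D) (take (suc x) (D ∷ p ++ q))) →
           ValleyAt D u (suc d) p q z
shift-D⁻ u d p q x (s≤s x≤) a b z≡ = valleyAt x x≤ a b (trans z≡ (cong₂ _,_ refl (+-suc d _)))

∈-valleys⁺ : ∀ t u d p q {z} → ValleyAt t u d p q z → z ∈ valleys t u d p
∈-valleys⁺ D u d [] q (valleyAt zero _ _ _ refl) = here (cong₂ _,_ (+-identityʳ u) (+-identityʳ d))
∈-valleys⁺ U u d (U ∷ p) q (valleyAt (suc x) x≤ a b z≡) = ∈-valleys⁺ U (suc u) d p q (shift-U⁻ u d p q x x≤ a b z≡)
∈-valleys⁺ U u d (D ∷ p) q (valleyAt (suc x) x≤ a b z≡) = ∈-valleys⁺ D u (suc d) p q (shift-D⁻ u d p q x x≤ a b z≡)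
∈-valleys⁺ D u d (U ∷ p) q (valleyAt zero _ _ _ refl) = here (cong₂ _,_ (+-identityʳ u) (+-identityʳ d))
∈-valleys⁺ D u d (U ∷ p) q (valleyAt (suc x) x≤ a b z≡) = there (∈-valleys⁺ U (suc u) d p q (shift-U⁻ u d p q x x≤ a b z≡))
∈-valleys⁺ D u d (D ∷ p) q (valleyAt zero _ _ () _)
∈-valleys⁺ D u d (D ∷ p) q (valleyAt (suc x) x≤ a b z≡) = ∈-valleys⁺ D u (suc d) p q (shift-D⁻ u d p q x x≤ a b z≡)

mirror-head : ∀ t p → ∃ λ q → mirror (t ∷ p) ≡ flip (lastOf t p) ∷ q
mirror-head t []      = [] , refl
mirror-head t (s ∷ p) with mirror-head s p
... | q , e = _ , trans (mirror-∷ t (s ∷ p)) (cong (_++ flip t ∷ []) e)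

pos : Point → Position
pos (u , d) = u + d , u ⊖ d

sum+difference : ∀ u d → + (u + d) ℤ.+ (u ⊖ d) ≡ + (u + u)
sum+difference u d = begin
  + (u + d) ℤ.+ (u ⊖ d)     ≡⟨ ℤ.distribʳ-⊖-+-pos (u + d) u d ⟩
  u + d + u ⊖ d             ≡⟨ cong₂ _⊖_ (trans (cong (_+ u) (+-comm u d)) (+-assoc d u u)) (sym (+-identityʳ d)) ⟩
  d + (u + u) ⊖ (d + 0)     ≡⟨ ℤ.+-cancelˡ-⊖ d (u + u) 0 ⟩
  + (u + u)                 ∎

pos-injective : ∀ {a b} → pos a ≡ pos b → a ≡ b
pos-injective {u , d} {u′ , d′} e = cong₂ _,_ u≡ (+-cancelˡ-≡ u′ d d′ (trans (cong (_+ d) (sym u≡)) (cong proj₁ e)))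
  where
  u≡ : u ≡ u′
  u≡ = *-cancelˡ-≡ u u′ 2 (trans (cong (λ z → u + z) (+-identityʳ u)) (trans
    (ℤ.+-injective (trans (sym (sum+difference u d)) (trans
      (cong (λ (a , b) → (+ a) ℤ.+ b) e) (sum+difference u′ d′))))
    (cong (λ z → u′ + z) (sym (+-identityʳ u′)))))

#-length : ∀ l → (# U) l + (# D) l ≡ length l
#-length []      = refl
#-length (U ∷ l) = cong suc (#-length l)
#-length (D ∷ l) = trans (+-suc _ _) (cong suc (#-length l))

valleys-unique : ∀ t u d p → Unique (valleys t u d p)
valleys-unique U u d []      = []
valleys-unique U u d (U ∷ p) = valleys-unique U (suc u) d p
valleys-unique U u d (D ∷ p) = valleys-unique D u (suc d) p
valleys-unique D u d []      = [] ∷ []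
valleys-unique D u d (U ∷ p) =
  All.tabulate (λ z∈ e → <-irrefl (cong proj₁ e) (proj₁ (valleysU-bound (suc u) d p z∈))) ∷ valleys-unique U (suc u) d p
valleys-unique D u d (D ∷ p) = valleys-unique D u (suc d) p

heightL : List Step → ℕ → ℤ
heightL l i = (# U) (take i l) ⊖ (# D) (take i l)

∈-map-pos⁻ : ∀ {z L} → pos z ∈ map pos L → z ∈ L
∈-map-pos⁻ z∈ with ∈-map⁻ pos z∈
... | _ , y∈ , e = subst (_∈ _) (sym (pos-injective e)) y∈

length-filter-map : ∀ {A B : Set} {P : Pred A 0ℓ} {Q : Pred B 0ℓ} (P? : Decidable P) (Q? : Decidable Q)
                    (g : A → B) xs → (∀ {x} → x ∈ xs → P x → Q (g x)) → (∀ {x} → x ∈ xs → Q (g x) → P x) →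
                    length (filter P? xs) ≡ length (filter Q? (map g xs))
length-filter-map P? Q? g []       to from = refl
length-filter-map P? Q? g (x ∷ xs) to from with P? x | Q? (g x)
  | length-filter-map P? Q? g xs (to ∘ there) (from ∘ there)
... | yes _  | yes _  | ih = cong suc ih
... | no _   | no _   | ih = ih
... | yes px | no ¬q  | _  = contradiction (to (here refl) px) ¬q
... | no ¬p  | yes qx | _  = contradiction (from (here refl) qx) ¬p

-- Translates the step `(x - 2 , y)` in suc_B into the diagonal step `pre`; positivity keeps the
-- subtractions from truncating.
pos-pre : ∀ {u d} → 0 < u → 0 < d → pos (pre (u , d)) ≡ (u + d ∸ 2 , u ⊖ d)
pos-pre {suc u} {suc d} _ _ = cong₂ _,_ (cong (_∸ 1) (sym (+-suc u d))) (sym (ℤ.[1+m]⊖[1+n]≡m⊖n u d))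

unique-⊆-length : ∀ {A : Set} {xs ys : List A} → Unique xs → xs ⊆ₗ ys → length ys ≤ length xs → ys ⊆ₗ xs
unique-⊆-length {xs = []} {[]} _ _ _ ()
unique-⊆-length {xs = x ∷ xs} {ys} (x∉ ∷ u) sub len {z} z∈ with ∈-∃++ (sub (here refl))
... | as , bs , refl = help (∈-++⁻ as z∈)
  where
  sub′ : xs ⊆ₗ as ++ bs
  sub′ y∈ with ∈-++⁻ as (sub (there y∈))
  ... | inj₁ y∈as          = ∈-++⁺ˡ y∈as
  ... | inj₂ (here refl)   = ⊥-elim (All.lookup x∉ y∈ refl)
  ... | inj₂ (there y∈bs)  = ∈-++⁺ʳ as y∈bs
  rec : as ++ bs ⊆ₗ xs
  rec = unique-⊆-length u sub′ (s≤s⁻¹ (subst (_≤ suc (length xs)) (List.length-++-sucʳ as x bs) len))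
  help : _ → z ∈ x ∷ xs
  help (inj₁ z∈as)         = there (rec (∈-++⁺ˡ z∈as))
  help (inj₂ (here refl))  = here refl
  help (inj₂ (there z∈bs)) = there (rec (∈-++⁺ʳ as z∈bs))

deduplicate-distinct : ∀ {A : Set} {R : A → A → Set} (R? : ∀ x y → Dec (R x y)) {xs} →
                       AllPairs (λ x y → ¬ R x y) xs → deduplicate R? xs ≡ xs
deduplicate-distinct R? []       = refl
deduplicate-distinct R? (r ∷ rs) = cong (_ ∷_) (trans (cong (filter _) (deduplicate-distinct R? rs))
  (List.filter-all _ r))

length-filter-filter-map :
  ∀ {A B : Set} {R P : Pred A 0ℓ} {Q : Pred B 0ℓ} (R? : Decidable R) (P? : Decidable P) (Q? : Decidable Q)
  (g : A → B) xs → (∀ {x} → x ∈ xs → R x → P x → Q (g x)) → (∀ {x} → x ∈ xs → Q (g x) → R x × P x) →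
  length (filter P? (filter R? xs)) ≡ length (filter Q? (map g xs))
length-filter-filter-map R? P? Q? g []       to from = refl
length-filter-filter-map R? P? Q? g (x ∷ xs) to from with R? x
  | length-filter-filter-map R? P? Q? g xs (to ∘ there) (from ∘ there)
... | no ¬r | ih = trans ih (cong length (sym (List.filter-reject Q? (¬r ∘ proj₁ ∘ from (here refl)))))
... | yes r | ih with P? x
... | no ¬p = trans ih (cong length (sym (List.filter-reject Q? (¬p ∘ proj₂ ∘ from (here refl)))))
... | yes p = trans (cong suc ih) (cong length (sym (List.filter-accept Q? (to (here refl) r p))))

-- Degrees and maximal faces

degree≡defect+length : ∀ p → degree U 0 p ≡ defect U 0 p + length (valleys U 0 0 p)
degree≡defect+length = degree-U 0 0 0

IsFace : ℕ → ℕ → List Step → Set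
IsFace i j p = length (valleys U 0 0 p) ≡ j × degree U 0 p ≡ i

isFace? : ∀ i j → Decidable (IsFace i j)
isFace? i j p = (length (valleys U 0 0 p) ≟ j) ×-dec (degree U 0 p ≟ i)

IsFacet : ℕ → ℕ → List Step → Set
IsFacet i s p = defect U 0 p ≡ 0 × degree U 0 p ≡ i × unitSteps U 0 p ≡ s

isFacet? : ∀ i s → Decidable (IsFacet i s)
isFacet? i s p = (defect U 0 p ≟ 0) ×-dec (degree U 0 p ≟ i) ×-dec (unitSteps U 0 p ≟ s)

module _ (n : ℕ) (1≤n : 1 ≤ n) where

  N : ℕ
  N = 2 * n

  -- `V` scans the indices below `2 * N`, and a valley in the middle has index `N`.
  N<2N : N < 2 * N
  N<2N = m<m+n N (≤-trans (≤-trans 1≤n (m≤m+n n _)) (m≤m+n N _))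

  vs : List Step → List Point
  vs = valleys U 0 0

  module _ {w : Vec Step (2 * N)} {p : List Step} (H : HalfOf N w (U ∷ p)) where

    q : List Step
    q = mirror (U ∷ p)

    q-head : head q ≡ just (flip (lastOf U p))
    q-head = cong head (proj₂ (mirror-head U p))

    pos-valley : ∀ x → x ≤ length p →
                 (suc x , height w (suc x)) ≡ pos (1 + (# U) (take x (p ++ q)) , (# D) (take x (p ++ q)))
    pos-valley x x≤ = cong₂ _,_
      (cong suc (sym (trans (#-length (take x (p ++ q))) (trans (List.length-take x (p ++ q))
        (m≤n⇒m⊓n≡m (≤-trans x≤ (List.length-++-≤ˡ p)))))))
      (cong (λ l → heightL l (suc x)) (word≡ H))

    Vhalf⇒valley : ∀ {z} → z ∈ Vhalf n w → z ∈ map pos (vs (U ∷ p))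
    Vhalf⇒valley z∈ with ∈-filter⁻ (λ z → proj₁ z ≤? N) {xs = V w} z∈
    ... | z∈V , i≤N with ∈-map⁻ _ z∈V
    ... | i , i∈ , refl with ∈-filter⁻ (isValley? w) {xs = upTo (2 * N)} i∈
    Vhalf⇒valley z∈ | _ , i≤N | suc x , _ , refl | _ , a , b =
      subst (_∈ map pos (vs (U ∷ p))) (sym (pos-valley x x≤)) (∈-map⁺ pos (∈-valleys⁺ U 1 0 p q
        (valleyAt x x≤ (subst (λ l → letterAt l x ≡ _) (word≡ H) a) (subst (λ l → letterAt l (suc x) ≡ _) (word≡ H) b) refl)))
      where
      x≤ : x ≤ length p
      x≤ = s≤s⁻¹ (subst (suc x ≤_) (sym (length≡ H)) i≤N)

    valley⇒Vhalf : ∀ {z} → z ∈ map pos (vs (U ∷ p)) → z ∈ Vhalf n w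
    valley⇒Vhalf z∈ with ∈-map⁻ pos z∈
    ... | _ , y∈ , refl with ∈-valleys⁻ U 1 0 p q q-head y∈
    ... | valleyAt x x≤ a b refl = subst (_∈ Vhalf n w) (pos-valley x x≤)
      (∈-filter⁺ (λ z → proj₁ z ≤? N) (∈-map⁺ (λ i → i , height w i)
        (∈-filter⁺ (isValley? w) (∈-upTo⁺ (≤-<-trans sx≤N N<2N))
          (subst (λ l → letterAt l x ≡ _) (sym (word≡ H)) a , subst (λ l → letterAt l (suc x) ≡ _) (sym (word≡ H)) b)))
        sx≤N)
      where
      sx≤N : suc x ≤ N
      sx≤N = subst (suc x ≤_) (length≡ H) (s≤s x≤)

  ballot-U : ∀ {p} → Ballot 0 p → length p ≡ N → ∃ λ p′ → p ≡ U ∷ p′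
  ballot-U (_ , up π) _ = _ , refl
  ballot-U (_ , []) e = contradiction (subst (1 ≤_) (sym e) (≤-trans 1≤n (m≤m+n n _))) λ ()

  Vhalf↭ : ∀ {w p} → HalfOf N w p → Vhalf n w ↭ map pos (vs p)
  Vhalf↭ {w} {p} H with ballot-U (ballot H) (length≡ H)
  ... | p′ , refl = unique-↭ (Vhalf-unique n w) (Unique.map⁺ pos-injective (valleys-unique U 0 0 p))
                     (Vhalf⇒valley H) (valley⇒Vhalf H)

  length-Vhalf : ∀ {w p} → HalfOf N w p → length (Vhalf n w) ≡ length (vs p)
  length-Vhalf {w} {p} H = trans (↭-length (Vhalf↭ H)) (List.length-map pos (vs p))

  Vhalf-⊆⁻ : ∀ {w p w′ p′} → HalfOf N w p → HalfOf N w′ p′ → Vhalf n w ⊆ Vhalf n w′ → vs p ⊆ₗ vs p′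
  Vhalf-⊆⁻ H H′ sub z∈ = ∈-map-pos⁻ (∈-resp-↭ (Vhalf↭ H′) (sub (∈-resp-↭ (↭-sym (Vhalf↭ H)) (∈-map⁺ pos z∈))))

  Vhalf-⊆⁺ : ∀ {w p w′ p′} → HalfOf N w p → HalfOf N w′ p′ → vs p ⊆ₗ vs p′ → Vhalf n w ⊆ Vhalf n w′
  Vhalf-⊆⁺ H H′ sub z∈ with ∈-map⁻ pos (∈-resp-↭ (Vhalf↭ H) z∈)
  ... | _ , y∈ , refl = ∈-resp-↭ (↭-sym (Vhalf↭ H′)) (∈-map⁺ pos (sub y∈))

  sucB≡unitSteps : ∀ {w p} → HalfOf N w p → sucB n w ≡ unitSteps U 0 p
  sucB≡unitSteps {w} {p} H with ballot-U (ballot H) (length≡ H)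
  ... | p′ , refl = begin
    sucB n w                              ≡⟨ ↭-length (filter-↭ _ (Vhalf↭ H)) ⟩
    length (filter _ (map pos (vs p)))    ≡⟨ length-filter-map Q? _ pos (vs p) (λ _ → id) (λ _ → id) ⟨
    length (filter Q? (vs p))             ≡⟨ length-filter-pre Q? (0 , 0) (vs p) chain to from ⟩
    unitGaps (0 , 0) (vs p)               ≡⟨ unitGapsU≡unitSteps 1 0 0 p′ ⟩
    unitSteps U 0 p                       ∎
    where
    Q? : Decidable (λ z → (proj₁ (pos z) ∸ 2 , proj₂ (pos z)) ∈ (0 , 0ℤ) ∷ Vhalf n w)
    Q? z = _ ∈? ((0 , 0ℤ) ∷ Vhalf n w)
    chain : Chain N (0 , 0) (vs p)
    chain = valleysU-chain 1 0 p′ ≤-refl ≤-refl (≤-reflexive (length≡ H))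
    pre≡ : ∀ {z} → z ∈ vs p → pos (pre z) ≡ (proj₁ (pos z) ∸ 2 , proj₂ (pos z))
    pre≡ z∈ = pos-pre (proj₁ (chain⇒< chain z∈)) (proj₂ (chain⇒< chain z∈))
    to : ∀ {z} → z ∈ vs p → (proj₁ (pos z) ∸ 2 , proj₂ (pos z)) ∈ (0 , 0ℤ) ∷ Vhalf n w → pre z ∈ (0 , 0) ∷ vs p
    to z∈ q with subst (_∈ (0 , 0ℤ) ∷ Vhalf n w) (sym (pre≡ z∈)) q
    ... | here e   = here (pos-injective e)
    ... | there v∈ = there (∈-map-pos⁻ (∈-resp-↭ (Vhalf↭ H) v∈))
    from : ∀ {z} → z ∈ vs p → pre z ∈ (0 , 0) ∷ vs p → (proj₁ (pos z) ∸ 2 , proj₂ (pos z)) ∈ (0 , 0ℤ) ∷ Vhalf n w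
    from z∈ (here e)   = subst (_∈ (0 , 0ℤ) ∷ Vhalf n w) (pre≡ z∈) (here (cong pos e))
    from z∈ (there v∈) = subst (_∈ (0 , 0ℤ) ∷ Vhalf n w) (pre≡ z∈)
      (there (∈-resp-↭ (↭-sym (Vhalf↭ H)) (∈-map⁺ pos v∈)))

  Vhalf∈Δ : ∀ {w p} → HalfOf N w p → Vhalf n w ∈ ΔSDyck n
  Vhalf∈Δ H = ∈-map⁺ (Vhalf n) (∈-SDyck⁺ N H)

  Δ⁻ : ∀ {τ} → τ ∈ ΔSDyck n → ∃₂ λ w p → HalfOf N w p × τ ≡ Vhalf n w
  Δ⁻ τ∈ with ∈-map⁻ (Vhalf n) τ∈
  ... | w , w∈ , e = w , half N w , ∈-SDyck⁻ N w∈ , e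

  length-superface≤degree : ∀ {w p w′ p′} → HalfOf N w p → HalfOf N w′ p′ → Vhalf n w ⊆ Vhalf n w′ →
                          length (Vhalf n w′) ≤ degree U 0 p
  length-superface≤degree H H′ sub
    with ballot-U (ballot H) (length≡ H) | ballot-U (ballot H′) (length≡ H′)
  ... | p₁ , refl | p₁′ , refl = subst (_≤ _) (sym (length-Vhalf H′))
    (length-valleys≤degree p₁ p₁′ (suc-injective (trans (length≡ H) (sym (length≡ H′)))) (Vhalf-⊆⁻ H H′ sub))

  superface : ∀ {w p} → HalfOf N w p →
              ∃₂ λ w′ p′ → HalfOf N w′ p′ × Vhalf n w ⊆ Vhalf n w′ × length (Vhalf n w′) ≡ degree U 0 p
  superface H with ballot-U (ballot H) (length≡ H) | ballot H
  ... | p₁ , refl | _ , up π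
    with fromHalf N (fillU 1 p₁) (trans (length-fillU 0 p₁) (length≡ H)) (fillU-ballot 0 p₁ (_ , π))
  ... | w′ , H′ = w′ , fillU 1 p₁ , H′ , Vhalf-⊆⁺ H H′ (valleys⊆fillU 0 0 0 p₁) ,
                  trans (length-Vhalf H′) (length-valleys-fillU 0 0 0 p₁)

  -- The capacity of the chain bounds every superface, and the filling attains the bound.
  deg≡degree : ∀ {w p} → HalfOf N w p → deg (ΔSDyck n) (Vhalf n w) ≡ degree U 0 p
  deg≡degree {w} {p} H = ≤-antisym (max≤v⁺ z≤n (All.map⁺ (All.tabulate upper))) lower
    where
    upper : ∀ {τ} → τ ∈ filter (Vhalf n w ⊆?_) (ΔSDyck n) → length τ ≤ degree U 0 p
    upper τ∈ with ∈-filter⁻ (Vhalf n w ⊆?_) {xs = ΔSDyck n} τ∈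
    ... | τ∈Δ , sub with Δ⁻ τ∈Δ
    ... | w′ , p′ , H′ , refl = length-superface≤degree H H′ sub
    lower : degree U 0 p ≤ deg (ΔSDyck n) (Vhalf n w)
    lower with superface H
    ... | w′ , p′ , H′ , sub , e = v≤max⁺ 0 (map length (filter (Vhalf n w ⊆?_) (ΔSDyck n))) (inj₂ (lose
      (∈-map⁺ length (∈-filter⁺ (Vhalf n w ⊆?_) (Vhalf∈Δ H′) sub)) (≤-reflexive (sym e))))

  -- A maximal face equals its filled superface, so its size is its degree.
  maximal⇒defect≡0 : ∀ {w p} → HalfOf N w p → IsMaximalFace (ΔSDyck n) (Vhalf n w) → defect U 0 p ≡ 0
  maximal⇒defect≡0 {w} {p} H max-w with superface H
  ... | w′ , p′ , H′ , sub , e = +-cancelʳ-≡ (length (vs p)) (defect U 0 p) 0 (begin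
    defect U 0 p + length (vs p)   ≡⟨ degree≡defect+length p ⟨
    degree U 0 p                   ≡⟨ e ⟨
    length (Vhalf n w′)
      ≡⟨ ↭-length (unique-↭ (Vhalf-unique n w′) (Vhalf-unique n w) (All.lookup max-w (Vhalf∈Δ H′) sub) sub) ⟩
    length (Vhalf n w)             ≡⟨ length-Vhalf H ⟩
    length (vs p)                  ∎)

  -- With defect 0 the bound on superfaces is the size of the face itself, and a superset without
  -- more elements is equal.
  defect≡0⇒maximal : ∀ {w p} → HalfOf N w p → defect U 0 p ≡ 0 → IsMaximalFace (ΔSDyck n) (Vhalf n w)
  defect≡0⇒maximal {w} {p} H defect≡0 = All.tabulate maximal
    where
    maximal : ∀ {τ} → τ ∈ ΔSDyck n → Vhalf n w ⊆ τ → τ ⊆ Vhalf n w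
    maximal τ∈ sub with Δ⁻ τ∈
    ... | w′ , p′ , H′ , refl = unique-⊆-length (Vhalf-unique n w) sub (≤-trans (length-superface≤degree H H′ sub)
      (≤-reflexive (trans (degree≡defect+length p) (trans (cong (_+ length (vs p)) defect≡0) (sym (length-Vhalf H))))))

  Vhalf-injective : ∀ {v w} → v ∈ SDyck N → w ∈ SDyck N → Vhalf n v ≐ Vhalf n w → v ≡ w
  Vhalf-injective v∈ w∈ (a , b) = half-injective N v∈ w∈
    (valleys-injective U 0 0 _ _ (trans (length≡ Hv) (sym (length≡ Hw))) (Vhalf-⊆⁻ Hv Hw a) (Vhalf-⊆⁻ Hw Hv b))
    where
    Hv = ∈-SDyck⁻ N v∈
    Hw = ∈-SDyck⁻ N w∈

  -- Distinct paths have distinct valley sets, so counting faces amounts to counting paths.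
  deduplicate-Δ : deduplicate _≐?_ (ΔSDyck n) ≡ ΔSDyck n
  deduplicate-Δ = deduplicate-distinct _≐?_
    (AllPairs.map⁺ (unique⇒allPairs (SDyck-unique N) λ v∈ w∈ v≢w e → v≢w (Vhalf-injective v∈ w∈ e)))

  f≡#faces : ∀ i j → f (ΔSDyck n) i j ≡ length (filter (isFace? i j) (ballots N 0))
  f≡#faces i j = begin
    f (ΔSDyck n) i j
      ≡⟨ cong (length ∘ filter _) deduplicate-Δ ⟩
    length (filter (λ σ → (length σ ≟ j) ×-dec (deg (ΔSDyck n) σ ≟ i)) (ΔSDyck n))
      ≡⟨ length-filter-map (isFace? i j ∘ half N) _ (Vhalf n) (SDyck N)
           (λ w∈ (a , b) → trans (length-Vhalf (∈-SDyck⁻ N w∈)) a , trans (deg≡degree (∈-SDyck⁻ N w∈)) b)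
           (λ w∈ (a , b) → trans (sym (length-Vhalf (∈-SDyck⁻ N w∈))) a , trans (sym (deg≡degree (∈-SDyck⁻ N w∈))) b) ⟨
    length (filter (isFace? i j ∘ half N) (SDyck N))
      ≡⟨ length-filter-map (isFace? i j ∘ half N) (isFace? i j) (half N) (SDyck N) (λ _ → id) (λ _ → id) ⟩
    length (filter (isFace? i j) (map (half N) (SDyck N)))
      ≡⟨ ↭-length (filter-↭ (isFace? i j) (map-half-SDyck N)) ⟩
    length (filter (isFace? i j) (ballots N 0)) ∎

  #facets : ∀ i s → length (filter (λ w → (length (Vhalf n w) ≟ i) ×-dec (sucB n w ≟ s)) (SDyckMax n)) ≡
                    length (filter (isFacet? i s) (ballots N 0))
  #facets i s = trans
    (length-filter-filter-map (λ w → isMaximalFace? (ΔSDyck n) (Vhalf n w)) _ (isFacet? i s) (half N) (SDyck N) to from)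
    (↭-length (filter-↭ (isFacet? i s) (map-half-SDyck N)))
    where
    to : ∀ {w} → w ∈ SDyck N → IsMaximalFace (ΔSDyck n) (Vhalf n w) →
         length (Vhalf n w) ≡ i × sucB n w ≡ s → IsFacet i s (half N w)
    to {w} w∈ max-w (a , b) = defect≡0 ,
      trans (degree≡defect+length (half N w)) (trans (cong (_+ length (vs (half N w))) defect≡0) (trans (sym (length-Vhalf H)) a)) ,
      trans (sym (sucB≡unitSteps H)) b
      where
      H = ∈-SDyck⁻ N w∈
      defect≡0 = maximal⇒defect≡0 H max-w
    from : ∀ {w} → w ∈ SDyck N → IsFacet i s (half N w) →
           IsMaximalFace (ΔSDyck n) (Vhalf n w) × length (Vhalf n w) ≡ i × sucB n w ≡ s
    from {w} w∈ (defect≡0 , a , b) = defect≡0⇒maximal H defect≡0 ,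
      trans (length-Vhalf H) (trans (sym (trans (degree≡defect+length (half N w)) (cong (_+ length (vs (half N w))) defect≡0))) a) ,
      trans (sucB≡unitSteps H) b
      where
      H = ∈-SDyck⁻ N w∈

-- Coefficients of the h-triangle

δ : ℕ → ℕ → ℤ
δ zero    zero    = 1ℤ
δ zero    (suc _) = 0ℤ
δ (suc _) zero    = 0ℤ
δ (suc m) (suc n) = δ m n

δ-≡ : ∀ n → δ n n ≡ 1ℤ
δ-≡ zero    = refl
δ-≡ (suc n) = δ-≡ n

δ-≢ : ∀ {m n} → m ≢ n → δ m n ≡ 0ℤ
δ-≢ {zero}  {zero}  m≢n = contradiction refl m≢n
δ-≢ {zero}  {suc n} m≢n = refl
δ-≢ {suc m} {zero}  m≢n = refl
δ-≢ {suc m} {suc n} m≢n = δ-≢ (m≢n ∘ cong suc)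

∑≤-cong : ∀ d {g g′ : ℕ → ℤ} → (∀ k → k ≤ d → g k ≡ g′ k) → ∑≤ d g ≡ ∑≤ d g′
∑≤-cong zero    e = e 0 z≤n
∑≤-cong (suc d) e = cong₂ ℤ._+_ (∑≤-cong d (λ k k≤d → e k (m≤n⇒m≤1+n k≤d))) (e (suc d) ≤-refl)

∑≤-zero : ∀ d {g : ℕ → ℤ} → (∀ k → k ≤ d → g k ≡ 0ℤ) → ∑≤ d g ≡ 0ℤ
∑≤-zero zero    e = e 0 z≤n
∑≤-zero (suc d) e = cong₂ ℤ._+_ (∑≤-zero d (λ k k≤d → e k (m≤n⇒m≤1+n k≤d))) (e (suc d) ≤-refl)

∑≤-single : ∀ d {g : ℕ → ℤ} k → k ≤ d → (∀ l → l ≤ d → l ≢ k → g l ≡ 0ℤ) → ∑≤ d g ≡ g k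
∑≤-single zero    zero k≤d e = refl
∑≤-single (suc d) {g} k k≤d e with k ≟ suc d
... | yes refl = trans (cong (ℤ._+ g (suc d)) (∑≤-zero d (λ l l≤d → e l (m≤n⇒m≤1+n l≤d) (<⇒≢ (s≤s l≤d))))) (ℤ.+-identityˡ _)
... | no k≢ = trans (cong₂ ℤ._+_ (∑≤-single d k (s≤s⁻¹ (≤∧≢⇒< k≤d k≢)) (λ l l≤d → e l (m≤n⇒m≤1+n l≤d)))
                (e (suc d) ≤-refl (k≢ ∘ sym))) (ℤ.+-identityʳ _)

∑≤-head₁ : ∀ d (g : ℕ → ℤ) → (∀ k → g (suc k) ≡ 0ℤ) → ∑≤ d g ≡ g 0
∑≤-head₁ d g e = ∑≤-single d 0 z≤n λ { zero _ 0≢0 → contradiction refl 0≢0 ; (suc l) _ _ → e l }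

∑≤-head₂ : ∀ d (g : ℕ → ℤ) → (∀ k → g (suc (suc k)) ≡ 0ℤ) → ∑≤ (suc d) g ≡ g 0 ℤ.+ g 1
∑≤-head₂ zero    g e = refl
∑≤-head₂ (suc d) g e = trans (cong₂ ℤ._+_ (∑≤-head₂ d g e) (e d)) (ℤ.+-identityʳ _)

const-⊗ : ∀ c p a b → (const c ⊗ p) a b ≡ c ℤ.* p a b
const-⊗ c p a b = trans (∑≤-head₁ a _ (λ k → ∑≤-zero b λ _ _ → refl)) (∑≤-head₁ b _ (λ k → refl))

X-⊗-zero : ∀ p b → (X ⊗ p) 0 b ≡ 0ℤ
X-⊗-zero p b = ∑≤-zero b λ _ _ → refl

X-⊗-suc : ∀ p a b → (X ⊗ p) (suc a) b ≡ p a b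
X-⊗-suc p a b = begin
  (X ⊗ p) (suc a) b   ≡⟨ ∑≤-head₂ a _ (λ k → ∑≤-zero b λ _ _ → refl) ⟩
  ∑≤ b (λ _ → 0ℤ) ℤ.+ ∑≤ b (λ b′ → X 1 b′ ℤ.* p a (b ∸ b′))
    ≡⟨ cong₂ ℤ._+_ (∑≤-zero b λ _ _ → refl) (∑≤-head₁ b _ (λ _ → refl)) ⟩
  0ℤ ℤ.+ 1ℤ ℤ.* p a b ≡⟨ ℤ.+-identityˡ _ ⟩
  1ℤ ℤ.* p a b        ≡⟨ ℤ.*-identityˡ _ ⟩
  p a b               ∎

X^-coeff : ∀ k a → (X ^ k) a 0 ≡ δ k a
X^-coeff zero    zero    = refl
X^-coeff zero    (suc a) = refl
X^-coeff (suc k) zero    = X-⊗-zero (X ^ k) 0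
X^-coeff (suc k) (suc a) = trans (X-⊗-suc (X ^ k) a 0) (X^-coeff k a)

X^-coeff-suc : ∀ k a b → (X ^ k) a (suc b) ≡ 0ℤ
X^-coeff-suc zero    zero    b = refl
X^-coeff-suc zero    (suc a) b = refl
X^-coeff-suc (suc k) zero    b = X-⊗-zero (X ^ k) (suc b)
X^-coeff-suc (suc k) (suc a) b = trans (X-⊗-suc (X ^ k) a (suc b)) (X^-coeff-suc k a b)

InY : Poly → Set
InY p = ∀ a b → p (suc a) b ≡ 0ℤ

⊗-InY : ∀ p q → InY p → InY q → InY (p ⊗ q)
⊗-InY p q p0 q0 a b = trans (∑≤-head₁ (suc a) _ (λ k → ∑≤-zero b λ b′ _ → cong (ℤ._* q (a ∸ k) (b ∸ b′)) (p0 k b′)))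
  (∑≤-zero b λ b′ _ → trans (cong (p 0 b′ ℤ.*_) (q0 a (b ∸ b′))) (ℤ.*-zeroʳ (p 0 b′)))

^-InY : ∀ p k → InY p → InY (p ^ k)
^-InY p zero    p0 a b = refl
^-InY p (suc k) p0 = ⊗-InY p (p ^ k) p0 (^-InY p k p0)

-- One factor is a multiple of a power of x and the other involves y only, so a single term of the
-- Cauchy product survives.
term-coeff : ∀ c k q → InY q → ∀ a b → (const c ⊗ X ^ k ⊗ q) a b ≡ c ℤ.* (δ k a ℤ.* q 0 b)
term-coeff c k q q0 a b = begin
  (m ⊗ q) a b
    ≡⟨ ∑≤-cong a (λ a′ _ → ∑≤-head₁ b _ (λ b′ → cong (ℤ._* q (a ∸ a′) (b ∸ suc b′)) (m-suc a′ b′))) ⟩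
  ∑≤ a (λ a′ → m a′ 0 ℤ.* q (a ∸ a′) b)
    ≡⟨ ∑≤-single a a ≤-refl off ⟩
  m a 0 ℤ.* q (a ∸ a) b
    ≡⟨ cong₂ ℤ._*_ (trans (const-⊗ c (X ^ k) a 0) (cong (c ℤ.*_) (X^-coeff k a))) (cong (λ z → q z b) (n∸n≡0 a)) ⟩
  c ℤ.* δ k a ℤ.* q 0 b
    ≡⟨ ℤ.*-assoc c (δ k a) (q 0 b) ⟩
  c ℤ.* (δ k a ℤ.* q 0 b) ∎
  where
  m : Poly
  m = const c ⊗ X ^ k
  m-suc : ∀ a b → m a (suc b) ≡ 0ℤ
  m-suc a b = trans (const-⊗ c (X ^ k) a (suc b)) (trans (cong (c ℤ.*_) (X^-coeff-suc k a b)) (ℤ.*-zeroʳ c))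
  off : ∀ l → l ≤ a → l ≢ a → m l 0 ℤ.* q (a ∸ l) b ≡ 0ℤ
  off l l≤a l≢a with a ∸ l | m<n⇒0<n∸m (≤∧≢⇒< l≤a l≢a)
  ... | suc z | _ = trans (cong (m l 0 ℤ.*_) (q0 z b)) (ℤ.*-zeroʳ (m l 0))

Y-InY : InY Y
Y-InY a b = refl

Y−1 : Poly
Y−1 = Y ⊕ const (ℤ.- 1ℤ)

Y−1-InY : InY Y−1
Y−1-InY a b = refl

⊗-coeff₀ : ∀ p q → (∀ b → p 0 (suc (suc b)) ≡ 0ℤ) → ∀ b →
           (p ⊗ q) 0 (suc b) ≡ p 0 0 ℤ.* q 0 (suc b) ℤ.+ p 0 1 ℤ.* q 0 b
⊗-coeff₀ p q p0 b = ∑≤-head₂ b _ (λ k → cong (ℤ._* q 0 (suc b ∸ suc (suc k))) (p0 k))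

Y^-coeff : ∀ m b → (Y ^ m) 0 b ≡ δ m b
Y^-coeff zero    zero    = refl
Y^-coeff zero    (suc b) = refl
Y^-coeff (suc m) zero    = refl
Y^-coeff (suc m) (suc b) = trans (⊗-coeff₀ Y (Y ^ m) (λ _ → refl) b)
  (trans (ℤ.+-identityˡ _) (trans (ℤ.*-identityˡ _) (Y^-coeff m b)))

-- The coefficient of y^b in (y - 1)^m y^s.
coeff : ℕ → ℕ → ℕ → ℤ
coeff b zero    s = δ s b
coeff b (suc m) s = coeff b m (suc s) ℤ.- coeff b m s

coeff-zero : ∀ m s → coeff 0 m (suc s) ≡ 0ℤ
coeff-zero zero    s = refl
coeff-zero (suc m) s = cong₂ ℤ._-_ (coeff-zero m (suc s)) (coeff-zero m s)

coeff-suc : ∀ b m s → coeff (suc b) m (suc s) ≡ coeff b m s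
coeff-suc b zero    s = refl
coeff-suc b (suc m) s = cong₂ ℤ._-_ (coeff-suc b m (suc s)) (coeff-suc b m s)

Y−1^-coeff : ∀ m b → (Y−1 ^ m) 0 b ≡ coeff b m 0
Y−1^-coeff zero    zero    = refl
Y−1^-coeff zero    (suc b) = refl
Y−1^-coeff (suc m) zero    = begin
  ℤ.- 1ℤ ℤ.* (Y−1 ^ m) 0 0   ≡⟨ ℤ.-1*i≡-i _ ⟩
  ℤ.- (Y−1 ^ m) 0 0          ≡⟨ cong ℤ.-_ (Y−1^-coeff m 0) ⟩
  ℤ.- coeff 0 m 0            ≡⟨ ℤ.+-identityˡ _ ⟨
  0ℤ ℤ.- coeff 0 m 0         ≡⟨ cong (ℤ._- coeff 0 m 0) (coeff-zero m 0) ⟨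
  coeff 0 (suc m) 0          ∎
Y−1^-coeff (suc m) (suc b) = begin
  (Y−1 ^ suc m) 0 (suc b)
    ≡⟨ ⊗-coeff₀ Y−1 (Y−1 ^ m) (λ _ → refl) b ⟩
  ℤ.- 1ℤ ℤ.* (Y−1 ^ m) 0 (suc b) ℤ.+ 1ℤ ℤ.* (Y−1 ^ m) 0 b
    ≡⟨ cong₂ ℤ._+_ (trans (ℤ.-1*i≡-i _) (cong ℤ.-_ (Y−1^-coeff m (suc b))))
                   (trans (ℤ.*-identityˡ _) (Y−1^-coeff m b)) ⟩
  ℤ.- coeff (suc b) m 0 ℤ.+ coeff b m 0
    ≡⟨ ℤ.+-comm (ℤ.- coeff (suc b) m 0) _ ⟩
  coeff b m 0 ℤ.- coeff (suc b) m 0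
    ≡⟨ cong (ℤ._- coeff (suc b) m 0) (coeff-suc b m 0) ⟨
  coeff (suc b) (suc m) 0 ∎

∑△-coeff : ∀ n (c : ℕ → ℕ → ℤ) (q : ℕ → Poly) → (∀ m → InY (q m)) → ∀ i b → i ≤ n →
           ∑△ n (λ i j → const (c i j) ⊗ X ^ i ⊗ q (i ∸ j)) i b ≡ ∑≤ i (λ j → c i j ℤ.* q (i ∸ j) 0 b)
∑△-coeff n c q q0 i b i≤n = trans (∑≤-single n i i≤n off) (∑≤-cong i λ j _ → on j)
  where
  off : ∀ l → l ≤ n → l ≢ i → ∑≤ l (λ j → (const (c l j) ⊗ X ^ l ⊗ q (l ∸ j)) i b) ≡ 0ℤ
  off l _ l≢i = ∑≤-zero l λ j _ → trans (term-coeff (c l j) l (q (l ∸ j)) (q0 _) i b)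
    (trans (cong (λ z → c l j ℤ.* (z ℤ.* q (l ∸ j) 0 b)) (δ-≢ l≢i)) (ℤ.*-zeroʳ (c l j)))
  on : ∀ j → (const (c i j) ⊗ X ^ i ⊗ q (i ∸ j)) i b ≡ c i j ℤ.* q (i ∸ j) 0 b
  on j = trans (term-coeff (c i j) i (q (i ∸ j)) (q0 _) i b)
    (cong (c i j ℤ.*_) (trans (cong (ℤ._* q (i ∸ j) 0 b) (δ-≡ i)) (ℤ.*-identityˡ _)))

-- For fixed `i` the exponents `i ∸ j` with `j ≤ i` are distinct, so the coefficient of x^i y^(i-j)
-- on the left isolates `h i j`.
hTriangle-coeff : ∀ n Δ h → IsHTriangle _≟ᵖ_ n Δ h → ∀ i j → j ≤ i → i ≤ n →
                  h i j ≡ ∑≤ i (λ k → + f Δ i k ℤ.* coeff (i ∸ j) (i ∸ k) 0)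
hTriangle-coeff n Δ h tri i j j≤i i≤n = begin
  h i j
    ≡⟨ ℤ.*-identityʳ (h i j) ⟨
  h i j ℤ.* 1ℤ
    ≡⟨ cong (h i j ℤ.*_) (trans (Y^-coeff (i ∸ j) (i ∸ j)) (δ-≡ (i ∸ j))) ⟨
  h i j ℤ.* (Y ^ (i ∸ j)) 0 (i ∸ j)
    ≡⟨ ∑≤-single i j j≤i off ⟨
  ∑≤ i (λ k → h i k ℤ.* (Y ^ (i ∸ k)) 0 (i ∸ j))
    ≡⟨ ∑△-coeff n h (Y ^_) (λ m → ^-InY Y m Y-InY) i (i ∸ j) i≤n ⟨
  ∑△ n (λ i j → const (h i j) ⊗ X ^ i ⊗ Y ^ (i ∸ j)) i (i ∸ j)
    ≡⟨ tri i (i ∸ j) ⟩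
  ∑△ n (λ i j → const (+ f Δ i j) ⊗ X ^ i ⊗ Y−1 ^ (i ∸ j)) i (i ∸ j)
    ≡⟨ ∑△-coeff n (λ i j → + f Δ i j) (Y−1 ^_) (λ m → ^-InY Y−1 m Y−1-InY) i (i ∸ j) i≤n ⟩
  ∑≤ i (λ k → + f Δ i k ℤ.* (Y−1 ^ (i ∸ k)) 0 (i ∸ j))
    ≡⟨ ∑≤-cong i (λ k _ → cong (+ f Δ i k ℤ.*_) (Y−1^-coeff (i ∸ k) (i ∸ j))) ⟩
  ∑≤ i (λ k → + f Δ i k ℤ.* coeff (i ∸ j) (i ∸ k) 0) ∎
  where
  off : ∀ l → l ≤ i → l ≢ j → h i l ℤ.* (Y ^ (i ∸ l)) 0 (i ∸ j) ≡ 0ℤ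
  off l l≤i l≢j = trans (cong (h i l ℤ.*_) (trans (Y^-coeff (i ∸ l) (i ∸ j)) (δ-≢ (l≢j ∘ ∸-cancelˡ-≡ l≤i j≤i))))
    (ℤ.*-zeroʳ (h i l))

-- Cardinalities as sums over ballot words

indicator : ∀ {P : Set} → Dec P → ℤ
indicator P? = if does P? then 1ℤ else 0ℤ

indicator-yes : ∀ {P : Set} (P? : Dec P) → P → indicator P? ≡ 1ℤ
indicator-yes P? p = cong (if_then 1ℤ else 0ℤ) (dec-true P? p)
indicator-no : ∀ {P : Set} (P? : Dec P) → ¬ P → indicator P? ≡ 0ℤ
indicator-no P? ¬p = cong (if_then 1ℤ else 0ℤ) (dec-false P? ¬p)

length-filter-++ : ∀ {A : Set} {P : Pred A 0ℓ} (P? : Decidable P) xs ys →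
                   + length (filter P? (xs ++ ys)) ≡ + length (filter P? xs) ℤ.+ + length (filter P? ys)
length-filter-++ P? xs ys = cong (λ l → + l) (trans (cong length (List.filter-++ P? xs ys)) (List.length-++ (filter P? xs)))

#ballots : ∀ {P : Pred (List Step) 0ℓ} (P? : Decidable P) r h →
           + length (filter P? (ballots r h)) ≡ ∑ballots r h (indicator ∘ P?)
#ballots P? zero h with P? []
... | yes _ = refl
... | no _  = refl
#ballots P? (suc r) zero = trans
  (cong (λ l → + l) (sym (length-filter-map (P? ∘ (U ∷_)) P? (U ∷_) (ballots r 1) (λ _ → id) (λ _ → id))))
  (#ballots (P? ∘ (U ∷_)) r 1)
#ballots P? (suc r) (suc h) = trans (length-filter-++ P? (map (U ∷_) (ballots r (suc (suc h)))) _)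
  (cong₂ ℤ._+_
    (trans (cong (λ l → + l) (sym (length-filter-map (P? ∘ (U ∷_)) P? (U ∷_) (ballots r (suc (suc h))) (λ _ → id) (λ _ → id))))
           (#ballots (P? ∘ (U ∷_)) r (suc (suc h))))
    (trans (cong (λ l → + l) (sym (length-filter-map (P? ∘ (D ∷_)) P? (D ∷_) (ballots r h) (λ _ → id) (λ _ → id))))
           (#ballots (P? ∘ (D ∷_)) r h)))

∑ballots-*ʳ : ∀ r h (g : List Step → ℤ) c → ∑ballots r h g ℤ.* c ≡ ∑ballots r h (λ p → g p ℤ.* c)
∑ballots-*ʳ zero    h       g c = refl
∑ballots-*ʳ (suc r) zero    g c = ∑ballots-*ʳ r 1 _ c
∑ballots-*ʳ (suc r) (suc h) g c = trans (ℤ.*-distribʳ-+ c (∑ballots r (suc (suc h)) _) _) (cong₂ ℤ._+_ (∑ballots-*ʳ r _ _ c) (∑ballots-*ʳ r h _ c))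

∑≤-∑ballots : ∀ d r h (g : ℕ → List Step → ℤ) → ∑≤ d (λ k → ∑ballots r h (g k)) ≡ ∑ballots r h (λ p → ∑≤ d (λ k → g k p))
∑≤-∑ballots zero    r h g = refl
∑≤-∑ballots (suc d) r h g = trans (cong (ℤ._+ ∑ballots r h (g (suc d))) (∑≤-∑ballots d r h g)) (∑ballots-+ r h _ _)

-- The coefficient of x^a y^b in x^i (y - 1)^m y^s.
monomial : ℕ → ℕ → (i m s : ℕ) → ℤ
monomial a b i m s = δ i a ℤ.* coeff b m s

-- The relation required of `ω`: y = (y - 1) + 1, read off one coefficient at a time.
monomial-split : ∀ a b i m s → monomial a b i m s ℤ.+ monomial a b i (suc m) s ≡ monomial a b i m (suc s)
monomial-split a b i m s = begin
  δ i a ℤ.* c m s ℤ.+ δ i a ℤ.* (c m (suc s) ℤ.- c m s)  ≡⟨ ℤ.*-distribˡ-+ (δ i a) (c m s) _ ⟨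
  δ i a ℤ.* (c m s ℤ.+ (c m (suc s) ℤ.- c m s))          ≡⟨ cong (δ i a ℤ.*_) (ℤ.+-comm (c m s) _) ⟩
  δ i a ℤ.* (c m (suc s) ℤ.- c m s ℤ.+ c m s)            ≡⟨ cong (δ i a ℤ.*_) (ℤ.+-assoc (c m (suc s)) _ _) ⟩
  δ i a ℤ.* (c m (suc s) ℤ.+ (ℤ.- c m s ℤ.+ c m s))      ≡⟨ cong (λ z → δ i a ℤ.* (c m (suc s) ℤ.+ z)) (ℤ.+-inverseˡ (c m s)) ⟩
  δ i a ℤ.* (c m (suc s) ℤ.+ 0ℤ)                         ≡⟨ cong (δ i a ℤ.*_) (ℤ.+-identityʳ _) ⟩
  δ i a ℤ.* c m (suc s)                                  ∎
  where
  c : ℕ → ℕ → ℤ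
  c = coeff b

-- Only the term with `k` the size of the face survives, and there `i ∸ k` is the defect.
face-monomial : ∀ i b p → ∑≤ i (λ k → indicator (isFace? i k p) ℤ.* coeff b (i ∸ k) 0)
                          ≡ monomial i b (degree U 0 p) (defect U 0 p) 0
face-monomial i b p = helper (degree U 0 p ≟ i)
  where
  size : ℕ
  size = length (valleys U 0 0 p)
  term : ℕ → ℤ
  term k = indicator (isFace? i k p) ℤ.* coeff b (i ∸ k) 0
  term-no : ∀ k → ¬ IsFace i k p → term k ≡ 0ℤ
  term-no k ¬face = cong (ℤ._* coeff b (i ∸ k) 0) (indicator-no (isFace? i k p) ¬face)
  helper : Dec (degree U 0 p ≡ i) → ∑≤ i term ≡ monomial i b (degree U 0 p) (defect U 0 p) 0
  helper (no deg≢i) = trans (∑≤-zero i (λ k _ → term-no k (deg≢i ∘ proj₂)))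
    (sym (cong (ℤ._* coeff b (defect U 0 p) 0) (δ-≢ deg≢i)))
  helper (yes deg≡i) = begin
    ∑≤ i term
      ≡⟨ ∑≤-single i size size≤i (λ k _ k≢ → term-no k (k≢ ∘ sym ∘ proj₁)) ⟩
    indicator (isFace? i size p) ℤ.* coeff b (i ∸ size) 0
      ≡⟨ cong₂ ℤ._*_ (indicator-yes (isFace? i size p) (refl , deg≡i)) (cong (λ m → coeff b m 0) i∸size) ⟩
    1ℤ ℤ.* coeff b (defect U 0 p) 0
      ≡⟨ cong (ℤ._* coeff b (defect U 0 p) 0) (trans (cong (δ (degree U 0 p)) (sym deg≡i)) (δ-≡ (degree U 0 p))) ⟨
    monomial i b (degree U 0 p) (defect U 0 p) 0 ∎
    where
    i≡ : i ≡ defect U 0 p + size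
    i≡ = trans (sym deg≡i) (degree≡defect+length p)
    size≤i : size ≤ i
    size≤i = subst (size ≤_) (sym i≡) (m≤n+m size (defect U 0 p))
    i∸size : i ∸ size ≡ defect U 0 p
    i∸size = trans (cong (_∸ size) i≡) (m+n∸n≡m (defect U 0 p) size)

facet-monomial : ∀ i s p → when (defect U 0 p) (monomial i s (degree U 0 p) 0 (unitSteps U 0 p))
                           ≡ indicator (isFacet? i s p)
facet-monomial i s p = helper (defect U 0 p) refl (degree U 0 p ≟ i) (unitSteps U 0 p ≟ s)
  where
  no-facet : ¬ IsFacet i s p → indicator (isFacet? i s p) ≡ 0ℤ
  no-facet = indicator-no (isFacet? i s p)
  helper : ∀ c → defect U 0 p ≡ c → Dec (degree U 0 p ≡ i) → Dec (unitSteps U 0 p ≡ s) →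
           when c (monomial i s (degree U 0 p) 0 (unitSteps U 0 p)) ≡ indicator (isFacet? i s p)
  helper (suc c) e _ _ = sym (no-facet λ (defect≡0 , _) → 0≢1+n (trans (sym defect≡0) e))
  helper zero e (no deg≢i) _ = trans (cong (ℤ._* δ (unitSteps U 0 p) s) (δ-≢ deg≢i))
    (sym (no-facet λ (_ , deg≡i , _) → deg≢i deg≡i))
  helper zero e (yes _) (no steps≢s) = trans (cong (δ (degree U 0 p) i ℤ.*_) (δ-≢ steps≢s))
    (trans (ℤ.*-zeroʳ (δ (degree U 0 p) i)) (sym (no-facet λ (_ , _ , steps≡s) → steps≢s steps≡s)))
  helper zero e (yes deg≡i) (yes steps≡s) = trans
    (cong₂ ℤ._*_ (trans (cong (δ (degree U 0 p)) (sym deg≡i)) (δ-≡ (degree U 0 p)))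
                 (trans (cong (δ (unitSteps U 0 p)) (sym steps≡s)) (δ-≡ (unitSteps U 0 p))))
    (sym (indicator-yes (isFacet? i s p) (e , deg≡i , steps≡s)))

theorem4p5 : (n : ℕ) → 1 ≤ n →
    (h : ℕ → ℕ → ℤ) → IsHTriangle _≟ᵖ_ n (ΔSDyck n) h →
    (i j : ℕ) → j ≤ i → i ≤ n →
    h i j ≡ + length (filter (λ w → (length (Vhalf n w) ≟ i) ×-dec (sucB n w ≟ i ∸ j)) (SDyckMax n))
theorem4p5 n@(suc n′) 1≤n h tri i j j≤i i≤n = begin
  h i j
    ≡⟨ hTriangle-coeff n (ΔSDyck n) h tri i j j≤i i≤n ⟩
  ∑≤ i (λ k → + f (ΔSDyck n) i k ℤ.* coeff b (i ∸ k) 0)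
    ≡⟨ ∑≤-cong i (λ k _ → trans
         (cong (ℤ._* coeff b (i ∸ k) 0) (trans (cong (λ l → + l) (f≡#faces n 1≤n i k)) (#ballots (isFace? i k) (2 * n) 0)))
         (∑ballots-*ʳ (2 * n) 0 (indicator ∘ isFace? i k) (coeff b (i ∸ k) 0))) ⟩
  ∑≤ i (λ k → ∑ballots (2 * n) 0 (λ p → indicator (isFace? i k p) ℤ.* coeff b (i ∸ k) 0))
    ≡⟨ ∑≤-∑ballots i (2 * n) 0 (λ k p → indicator (isFace? i k p) ℤ.* coeff b (i ∸ k) 0) ⟩
  ∑ballots (2 * n) 0 (λ p → ∑≤ i (λ k → indicator (isFace? i k p) ℤ.* coeff b (i ∸ k) 0))
    ≡⟨ ∑ballots-cong (2 * n) 0 (face-monomial i b) ⟩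
  ∑ballots (2 * n) 0 (λ p → monomial i b (degree U 0 p) (defect U 0 p) 0)
    -- `2 * n` computes to `suc (n′ + 1 * n)`, and from height 0 the first letter is U; both sums
    -- therefore reduce to sums from height 1 over the remaining letters.
    ≡⟨ ∑-faces≡∑-facets (monomial i b) (monomial-split i b) (n′ + 1 * n) ⟩
  ∑ballots (2 * n) 0 (λ p → when (defect U 0 p) (monomial i b (degree U 0 p) 0 (unitSteps U 0 p)))
    ≡⟨ ∑ballots-cong (2 * n) 0 (facet-monomial i b) ⟩
  ∑ballots (2 * n) 0 (indicator ∘ isFacet? i b)
    ≡⟨ #ballots (isFacet? i b) (2 * n) 0 ⟨
  + length (filter (isFacet? i b) (ballots (2 * n) 0))
    ≡⟨ cong (λ l → + l) (#facets n 1≤n i b) ⟨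
  + length (filter (λ w → (length (Vhalf n w) ≟ i) ×-dec (sucB n w ≟ i ∸ j)) (SDyckMax n)) ∎
  where
  b : ℕ
  b = i ∸ j
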